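{- Let $(G,c,\gamma)$ be an M2VPI system and run Algorithm 3 (described in the context) on it. If Algorithm 3 returns labels $y\in(\mathbb{R}\cup\{\infty\})^V$, then $y=y^{\max}$ provided the system is feasible. If Algorithm 3 returns INFEASIBLE, then the system is infeasible.
   Context: An M2VPI system: directed multigraph $G=(V,E)$, $n=|V|$, arc costs $c\in\mathbb{R}^E$, gains $\gamma\in\mathbb{R}^E_{>0}$; arc $e=(v,w)$ encodes $y_v-\gamma_ey_w\le c_e$. If feasible, $y^{\max}\in(\mathbb{R}\cup\{\infty\})^V$ is its pointwise maximal solution, with $y^{\max}_u=\infty$ iff $y_u$ is unbounded from above over the feasible set. Notation: for a walk $P$ with arcs $e_1,\dots,e_k$, $c(P):=\sum_i(\prod_{j<i}\gamma_{e_j})c_{e_i}$, $\gamma(P):=\prod_i\gamma_{e_i}$; a cycle at $u$ is a $u$-$u$ walk with distinct intermediate nodes, flow-absorbing if $\gamma(C)<1$; arc $(v,w)$ is violated w.r.t. labels $y$ if $y_v>c_{vw}+\gamma_{vw}y_w$. Grapevine$(H,y,s)$: for rounds $i=1,\dots,n$, every node $v$ simultaneously sets $y_v:=\min(y_v,\min_{vw\in\delta^+(v)}c_{vw}+\gamma_{vw}y_w)$, recording a minimizing arc $\mathrm{pred}(v,i)$ if $y_v$ decreased (ties broken arbitrarily); returns the new labels and the walk from $s$ traced by following recorded arcs in reverse chronological order from $\mathrm{pred}(s,n)$ (reading $\mathrm{pred}(v,i-1)$ if $\mathrm{pred}(v,i)$ is empty). $H_u$: split $u$ into $u$ (keeping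 outgoing arcs) and a new sink $u'$ receiving all arcs of $H$ entering $u$ (same costs and gains). Algorithm 3: $y\equiv\infty$, $G^{(0)}=(V,\emptyset)$; for each $u\in V$ in turn (phase $k$): $G^{(k)}:=G^{(k-1)}\cup\delta^+(u)$; $y_u:=\min_{uv\in\delta^+(u)}c_{uv}+\gamma_{uv}y_v$; if $y_u=\infty$ and there is a flow-absorbing cycle $C$ at $u$ in $G^{(k)}$, $y_u:=c(C)/(1-\gamma(C))$. If $y_u<\infty$: set $\bar y_{u'}:=y_u$, $\bar y_v:=y_v$ ($v\in V$), run Grapevine$(G^{(k)}_u,\bar y,u)$ getting $(\bar y,P)$; return INFEASIBLE if an arc of $G^{(k)}_u$ is violated w.r.t. $\bar y$ or $P$ has at least one arc and $\gamma(P)\ge1$. Otherwise run the look-ahead Newton–Dinkelbach method with initial point $\bar y_{u'}$ and supergradient $\gamma(P)-1$ on $f(\delta):=\inf\{c^\top x+\delta\sum_{e\in\delta^-(u)}\gamma_ex_e-\delta: x\in\mathbb{R}^{E(G^{(k)})}_{\ge0},\ x(\delta^+(u))=1,\ \sum_{e\in\delta^+(v)}x_e-\sum_{e\in\delta^-(v)}\gamma_ex_e=0\ \forall v\ne u\}$; its oracle at $\delta$ sets $\bar y_{u'}:=\delta$ and runs Grapevine$(G^{(k)}_u,\bar y,u)$ (updating $\bar y$): $f(\delta)=-\infty$ if an arc remains violated, otherwise $f(\delta)=\bar y_u-\delta$ with supergradient $\gamma(P)-1$ if the returned walk $P$ ends at $u'$ and $-1$ otherwise. The method: from $(\delta^{(i)},g^{(i)})$,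 stop with $\delta^{(i)}$ if $f(\delta^{(i)})=0$; else $\delta:=\delta^{(i)}-f(\delta^{(i)})/g^{(i)}$ with supergradient $g$, NO ROOT if $f(\delta)=-\infty$ or ($f(\delta)<0$, $g\ge0$); try $\delta':=2\delta-\delta^{(i)}$ and use it if $-\infty<f(\delta')<0$ with negative supergradient; continue from the chosen point. If NO ROOT, return INFEASIBLE; else $y:=\bar y|_V$. After all phases return $y$. -}

module Defs where

open import Level using (Level; _⊔_) renaming (suc to lsuc)
open import Algebra.Core using (Op₁; Op₂)
open import Algebra.Structures using (IsCommutativeRing)
open import Data.Bool.Base using (if_then_else_)
open import Data.Fin.Base using (Fin; zero; suc)
open import Data.Fin.Properties using (_≟_)
open import Data.Fin.Subset using (Subset; _∈_; _∪_; ⊥)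
open import Data.Fin.Subset.Properties using (_∈?_)
open import Data.List.Base using (List; []; _∷_; map; filter; allFin)
open import Data.List.Extrema using (min)
open import Data.List.Relation.Binary.Permutation.Propositional using (_↭_)
open import Data.List.Relation.Unary.Unique.Propositional using (Unique)
open import Data.Maybe.Base using (Maybe; just; nothing)
import Data.Maybe.Base as Maybe
open import Data.Nat.Base as ℕ using (ℕ; zero; suc)
open import Data.Product.Base using (_×_; _,_; ∃; ∃-syntax)
open import Data.Sum.Base using (_⊎_)
open import Data.Vec.Base using (tabulate)
import Data.Vec.Functional as Vector
open import Function.Base using (_∘_; const)
open import Function.Bundles using (_⇔_)
open import Relation.Binary.Bundles using (TotalOrder)
open import Relation.Binary.Core using (Rel)
import Relation.Binary.Construct.Add.Supremum.NonStrict as SupremumNonStrict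
import Relation.Binary.Construct.Add.Supremum.Strict as SupremumStrict
import Relation.Binary.Construct.NonStrictToStrict as NonStrictToStrict
open import Relation.Binary.PropositionalEquality.Core using (_≡_; _≢_)
open import Relation.Binary.Structures using (IsDecTotalOrder)
open import Relation.Nullary.Construct.Add.Supremum using (_⁺; ⊤⁺; [_])
open import Relation.Nullary.Decidable using (does; _×-dec_)
open import Relation.Nullary.Negation using (¬_)

-- The scalars. The library has no real numbers; ℝ with its usual (classically
-- decidable) order is one such field. The value 0# ⁻¹ is unconstrained.
record OrderedField (a ℓ : Level) : Set (lsuc (a ⊔ ℓ)) where
  infix  8 _⁻¹
  infix  8 -_
  infixl 7 _*_
  infixl 6 _+_
  infix  4 _≤_
  field
    Carrier           : Set a
    _≤_               : Rel Carrier ℓ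
    _+_ _*_           : Op₂ Carrier
    -_ _⁻¹            : Op₁ Carrier
    0# 1#             : Carrier
    isCommutativeRing : IsCommutativeRing _≡_ _+_ _*_ -_ 0# 1#
    0≢1               : 0# ≢ 1#
    ⁻¹-inverseʳ       : ∀ x → x ≢ 0# → x * x ⁻¹ ≡ 1#
    isDecTotalOrder   : IsDecTotalOrder _≡_ _≤_
    +-monoˡ-≤         : ∀ z {x y} → x ≤ y → x + z ≤ y + z
    *-nonNegative     : ∀ {x y} → 0# ≤ x → 0# ≤ y → 0# ≤ x * y

  open NonStrictToStrict _≡_ _≤_ public using (_<_)

  infixl 7 _÷_
  infixl 6 _-_

  _-_ : Op₂ Carrier
  x - y = x + - y

  _÷_ : Op₂ Carrier
  x ÷ y = x * y ⁻¹

module Algorithm {a ℓ : Level} (K : OrderedField a ℓ) where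

  open OrderedField K
  open SupremumNonStrict _≤_ public using (_≤⁺_; ≤⁺-isTotalOrder-≡)
  open SupremumStrict _<_ public using (_<⁺_)

  ≤⁺-totalOrder : TotalOrder a a (a ⊔ ℓ)
  ≤⁺-totalOrder = record
    { isTotalOrder = ≤⁺-isTotalOrder-≡ (IsDecTotalOrder.isTotalOrder isDecTotalOrder) }

  -- Arc e = (v , w) encodes  y v - gain e * y w ≤ cost e.
  record System (n m : ℕ) : Set (a ⊔ ℓ) where
    field
      src tgt    : Fin m → Fin n
      cost gain  : Fin m → Carrier
      gain>0     : ∀ e → 0# < gain e

  -- ⊤⁺ is the label ∞.
  Labels : ℕ → Set a
  Labels n = Fin n → Carrier ⁺

  module _ {n m : ℕ} (G : System n m) where
    open System G

    IsSolution : (Fin n → Carrier) → Set ℓ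
    IsSolution z = ∀ e → z (src e) - gain e * z (tgt e) ≤ cost e

    Feasible : Set (a ⊔ ℓ)
    Feasible = ∃ IsSolution

    UnboundedAbove : Fin n → Set (a ⊔ ℓ)
    UnboundedAbove v = ∀ b → ∃[ z ] IsSolution z × b < z v

    record IsYMax (y : Labels n) : Set (a ⊔ ℓ) where
      field
        dominates : ∀ z → IsSolution z → ∀ v → [ z v ] ≤⁺ y v
        attained  : ∃[ z ] IsSolution z × (∀ v {r} → y v ≡ [ r ] → z v ≡ r)
        infinite  : ∀ v → y v ≡ ⊤⁺ ⇔ UnboundedAbove v

    -- Walks are given by their arc lists.

    data IsWalk (A : Subset m) : Fin n → Fin n → List (Fin m) → Set where
      []  : ∀ {v} → IsWalk A v v []
      _∷_ : ∀ {e t P} → e ∈ A → IsWalk A (tgt e) t P → IsWalk A (src e) t (e ∷ P)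

    walkEnd : Fin n → List (Fin m) → Fin n
    walkEnd s []      = s
    walkEnd s (e ∷ P) = walkEnd (tgt e) P

    walkGain : List (Fin m) → Carrier
    walkGain []      = 1#
    walkGain (e ∷ P) = gain e * walkGain P

    -- Horner form of  Σᵢ (Πⱼ₍ⱼ<ᵢ₎ gain eⱼ) * cost eᵢ.
    walkCost : List (Fin m) → Carrier
    walkCost []      = 0#
    walkCost (e ∷ P) = cost e + gain e * walkCost P

    -- The sources of the arcs of a closed walk at u are u and the
    -- intermediate nodes.
    IsCycleAt : Subset m → Fin n → List (Fin m) → Set
    IsCycleAt A u C = C ≢ [] × IsWalk A u u C × Unique (map src C)

    FlowAbsorbingCycleAt : Subset m → Fin n → List (Fin m) → Set (a ⊔ ℓ)
    FlowAbsorbingCycleAt A u C = IsCycleAt A u C × walkGain C < 1#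

    -- A subgraph with node set Fin n is given by its arc set A.

    δ⁺ : Fin n → Subset m
    δ⁺ v = tabulate λ e → does (src e ≟ v)

    outArcs : Subset m → Fin n → List (Fin m)
    outArcs A v = filter (λ e → (e ∈? A) ×-dec (src e ≟ v)) (allFin m)

    arcBound : Labels n → Fin m → Carrier ⁺
    arcBound y e = Maybe.map (λ t → cost e + gain e * t) (y (tgt e))

    minOut : Subset m → Labels n → Fin n → Carrier ⁺
    minOut A y v = min ≤⁺-totalOrder ⊤⁺ (map (arcBound y) (outArcs A v))

    HasViolatedArc : Subset m → Labels n → Set (a ⊔ ℓ)
    HasViolatedArc A y = ∃[ e ] e ∈ A × arcBound y e <⁺ y (src e)

    relax : Subset m → Labels n → Labels n
    relax A y v = min ≤⁺-totalOrder (y v) (map (arcBound y) (outArcs A v))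

    -- Labels of Grapevine after the given number of rounds.
    grapevine : ℕ → Subset m → Labels n → Labels n
    grapevine zero    A y = y
    grapevine (suc i) A y = relax A (grapevine i A y)

    -- The admissible values of pred(v , i) when y are the labels before
    -- round i; ties may be broken in any way.
    data Recorded (A : Subset m) (y : Labels n) (v : Fin n) : Maybe (Fin m) → Set (a ⊔ ℓ) where
      decreased : ∀ {e} → relax A y v <⁺ y v → e ∈ A → src e ≡ v →
                  arcBound y e ≡ relax A y v → Recorded A y v (just e)
      unchanged : relax A y v ≡ y v → Recorded A y v nothing

    -- pred i v is the arc recorded at v in round i + 1.
    trace : (ℕ → Fin n → Maybe (Fin m)) → ℕ → Fin n → List (Fin m)
    trace pred zero    s = []
    trace pred (suc i) s with pred i s
    ... | nothing = trace pred i s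
    ... | just e  = e ∷ trace pred i (tgt e)

    GrapevineWalk : ℕ → Subset m → Labels n → Fin n → List (Fin m) → Set (a ⊔ ℓ)
    GrapevineWalk rounds A y s P =
      ∃[ pred ] (∀ i → i ℕ.< rounds → ∀ v → Recorded A (grapevine i A y) v (pred i v))
              × P ≡ trace pred rounds s

  -- H_u: node zero is the new sink u′ and node suc v is v.
  split : ∀ {n m} → System n m → Fin n → System (suc n) m
  split G u = record
    { src    = suc ∘ src
    ; tgt    = λ e → if does (tgt e ≟ u) then zero else suc (tgt e)
    ; cost   = cost
    ; gain   = gain
    ; gain>0 = gain>0
    } where open System G

  module _ {n m : ℕ} (G : System n m) where

    module NewtonDinkelbach (A : Subset m) (u : Fin n) where

      Gᵤ : System (suc n) m
      Gᵤ = split G u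

      -- value f g ȳ: function value f, supergradient g, resulting labels ȳ.
      data Evaluation : Set a where
        -∞    : Evaluation
        value : (f g : Carrier) (ȳ : Labels (suc n)) → Evaluation

      supergradient : List (Fin m) → Carrier
      supergradient P =
        if does (walkEnd Gᵤ (suc u) P ≟ zero) then walkGain Gᵤ P - 1# else - 1#

      setSink : Carrier → Labels (suc n) → Labels (suc n)
      setSink δ ȳ = Vector.updateAt ȳ zero (const [ δ ])

      data Oracle (ȳ : Labels (suc n)) (δ : Carrier) : Evaluation → Set (a ⊔ ℓ) where
        violated : HasViolatedArc Gᵤ A (grapevine Gᵤ n A (setSink δ ȳ)) → Oracle ȳ δ -∞
        finite   : ∀ {P b} →
                   ¬ HasViolatedArc Gᵤ A (grapevine Gᵤ n A (setSink δ ȳ)) →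
                   GrapevineWalk Gᵤ n A (setSink δ ȳ) (suc u) P →
                   grapevine Gᵤ n A (setSink δ ȳ) (suc u) ≡ [ b ] →
                   Oracle ȳ δ (value (b - δ) (supergradient P) (grapevine Gᵤ n A (setSink δ ȳ)))

      data CertifiesNoRoot : Evaluation → Set (a ⊔ ℓ) where
        -∞       : CertifiesNoRoot -∞
        negative : ∀ {f g ȳ} → f < 0# → 0# ≤ g → CertifiesNoRoot (value f g ȳ)

      data Acceptable : Evaluation → Set (a ⊔ ℓ) where
        acceptable : ∀ {f g ȳ} → f < 0# → g < 0# → Acceptable (value f g ȳ)

      data Result : Set a where
        root   : (δ : Carrier) (ȳ : Labels (suc n)) → Result
        noRoot : Result

      newtonPoint : (δ f g : Carrier) → Carrier
      newtonPoint δ f g = δ - f ÷ g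

      lookAheadPoint : (δ₁ δ : Carrier) → Carrier
      lookAheadPoint δ₁ δ = (1# + 1#) * δ₁ - δ

      -- Newton δ f g ȳ r: from the iterate δ with function value f,
      -- supergradient g and labels ȳ, the method stops with r. The labels
      -- are always those of the current iterate: the labels computed at a
      -- look-ahead point are dropped when that point is not used.
      data Newton (δ f g : Carrier) (ȳ : Labels (suc n)) : Result → Set (a ⊔ ℓ) where
        stop   : f ≡ 0# → Newton δ f g ȳ (root δ ȳ)
        fail   : ∀ {ev} → f ≢ 0# →
                 Oracle ȳ (newtonPoint δ f g) ev → CertifiesNoRoot ev →
                 Newton δ f g ȳ noRoot
        accept : ∀ {f₁ g₁ ȳ₁ f₂ g₂ ȳ₂ r} → f ≢ 0# →
                 let δ₁ = newtonPoint δ f g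
                     δ₂ = lookAheadPoint δ₁ δ in
                 Oracle ȳ δ₁ (value f₁ g₁ ȳ₁) → ¬ CertifiesNoRoot (value f₁ g₁ ȳ₁) →
                 Oracle ȳ₁ δ₂ (value f₂ g₂ ȳ₂) → Acceptable (value f₂ g₂ ȳ₂) →
                 Newton δ₂ f₂ g₂ ȳ₂ r → Newton δ f g ȳ r
        reject : ∀ {f₁ g₁ ȳ₁ ev r} → f ≢ 0# →
                 let δ₁ = newtonPoint δ f g
                     δ₂ = lookAheadPoint δ₁ δ in
                 Oracle ȳ δ₁ (value f₁ g₁ ȳ₁) → ¬ CertifiesNoRoot (value f₁ g₁ ȳ₁) →
                 Oracle ȳ₁ δ₂ ev → ¬ Acceptable ev →
                 Newton δ₁ f₁ g₁ ȳ₁ r → Newton δ f g ȳ r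

    data Outcome : Set a where
      returns    : Labels n → Outcome
      infeasible : Outcome

    -- The value of y u at the start of the phase of u, A being the arc set
    -- of the current graph.
    data InitialLabel (A : Subset m) (y : Labels n) (u : Fin n) : Carrier ⁺ → Set (a ⊔ ℓ) where
      minimum : ∀ {δ} → minOut G A y u ≡ [ δ ] → InitialLabel A y u [ δ ]
      cycle   : ∀ {C} → minOut G A y u ≡ ⊤⁺ → FlowAbsorbingCycleAt G A u C →
                InitialLabel A y u [ walkCost G C ÷ (1# - walkGain G C) ]
      noCycle : minOut G A y u ≡ ⊤⁺ → (∀ C → ¬ FlowAbsorbingCycleAt G A u C) →
                InitialLabel A y u ⊤⁺

    setLabel : Fin n → Carrier ⁺ → Labels n → Labels n
    setLabel u t y = Vector.updateAt y u (const t)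

    splitLabels : Labels n → Fin n → Carrier → Labels (suc n)
    splitLabels y u δ = [ δ ] Vector.∷ setLabel u [ δ ] y

    data Phase (A : Subset m) (y : Labels n) (u : Fin n) : Outcome → Set (a ⊔ ℓ) where
      skip : InitialLabel A y u ⊤⁺ → Phase A y u (returns (setLabel u ⊤⁺ y))
      reject : ∀ {δ P} → InitialLabel A y u [ δ ] →
        let open NewtonDinkelbach A u
            ȳ = splitLabels y u δ in
        GrapevineWalk Gᵤ n A ȳ (suc u) P →
        HasViolatedArc Gᵤ A (grapevine Gᵤ n A ȳ) ⊎ (P ≢ [] × 1# ≤ walkGain Gᵤ P) →
        Phase A y u infeasible
      newtonFails : ∀ {δ P b} → InitialLabel A y u [ δ ] →
        let open NewtonDinkelbach A u
            ȳ  = splitLabels y u δ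
            ȳ₁ = grapevine Gᵤ n A ȳ in
        GrapevineWalk Gᵤ n A ȳ (suc u) P →
        ¬ (HasViolatedArc Gᵤ A ȳ₁ ⊎ (P ≢ [] × 1# ≤ walkGain Gᵤ P)) →
        ȳ₁ (suc u) ≡ [ b ] →
        Newton δ (b - δ) (walkGain Gᵤ P - 1#) ȳ₁ noRoot →
        Phase A y u infeasible
      newtonSucceeds : ∀ {δ P b δ* ȳ*} → InitialLabel A y u [ δ ] →
        let open NewtonDinkelbach A u
            ȳ  = splitLabels y u δ
            ȳ₁ = grapevine Gᵤ n A ȳ in
        GrapevineWalk Gᵤ n A ȳ (suc u) P →
        ¬ (HasViolatedArc Gᵤ A ȳ₁ ⊎ (P ≢ [] × 1# ≤ walkGain Gᵤ P)) →
        ȳ₁ (suc u) ≡ [ b ] →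
        Newton δ (b - δ) (walkGain Gᵤ P - 1#) ȳ₁ (root δ* ȳ*) →
        Phase A y u (returns (ȳ* ∘ suc))

    data Phases : List (Fin n) → Subset m → Labels n → Outcome → Set (a ⊔ ℓ) where
      done : ∀ {A y} → Phases [] A y (returns y)
      fail : ∀ {u us A y} → Phase (A ∪ δ⁺ G u) y u infeasible →
             Phases (u ∷ us) A y infeasible
      next : ∀ {u us A y y′ o} → Phase (A ∪ δ⁺ G u) y u (returns y′) →
             Phases us (A ∪ δ⁺ G u) y′ o → Phases (u ∷ us) A y o

    -- Some execution ends with the given outcome; the processing order, the
    -- recorded arcs and the flow-absorbing cycles are arbitrary.
    Algorithm3 : Outcome → Set (a ⊔ ℓ)
    Algorithm3 o = ∃[ order ] order ↭ allFin n × Phases order ⊥ (const ⊤⁺) o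

{-# OPTIONS --safe #-}

-- Invariant after each phase: y dominates every solution of the current
-- subsystem, violates none of its arcs, and there is a nonnegative recession
-- direction (a "ray") of the subsystem that is positive wherever y = ∞. At the
-- end, adding a large multiple of the ray to a solution shows that y = y^max.
--
-- In the phase of u, all labels stay between the solutions (with u′ and u
-- identified) and a valid labelling of G_u obtained from the old y, so by
-- affinity no closed walk can lower a label: a traced walk never revisits a
-- node, and n rounds of Grapevine leave no violated arc unless the system is
-- infeasible. Each supergradient comes from a line t ↦ c + γ t with
-- z u ≤ c + γ * z u for every solution z, hence no Newton or accepted
-- look-ahead point falls below z u. If y u stays ∞, a new ray is obtained by
-- running Grapevine on the system with all costs 0: a label of u below its
-- initial value would trace out a flow-absorbing cycle at u.
module Submission where

open import Defs
open import Level using (Level; _⊔_)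
open import Algebra.Bundles using (CommutativeRing)
import Algebra.Properties.Ring as RingProperties
import Algebra.Solver.Ring.NaturalCoefficients.Default as SemiringSolver
open import Data.Fin.Base using (Fin; zero; suc)
import Data.Fin.Properties as Fin
open import Data.Fin.Subset using (Subset; _∈_; _⊆_; _∪_) renaming (⊥ to ∅)
open import Data.Fin.Subset.Properties using (_∈?_; p⊆p∪q; q⊆p∪q; x∈p∪q⁻; ∉⊥)
open import Data.List.Base using (List; []; _∷_; map; length; lookup; allFin)
import Data.List.Extrema as Extrema
open import Data.List.Membership.Propositional using () renaming (_∈_ to _∈ₗ_)
open import Data.List.Membership.Propositional.Properties using (∈-map⁺; ∈-map⁻; ∈-filter⁺; ∈-filter⁻; ∈-allFin; ∈-lookup)
open import Data.List.Properties using (map-∘; length-map)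
open import Data.List.Relation.Binary.Permutation.Propositional using (↭-sym)
open import Data.List.Relation.Binary.Permutation.Propositional.Properties using (∈-resp-↭)
import Data.List.Relation.Unary.All as All
open import Data.List.Relation.Unary.All.Properties using (¬Any⇒All¬)
open import Data.List.Relation.Unary.AllPairs using ([]; _∷_)
open import Data.List.Relation.Unary.Any using (here; there)
open import Data.List.Relation.Unary.Unique.Propositional using (Unique)
import Data.List.Relation.Unary.Unique.Propositional.Properties as Unique
open import Data.Maybe.Base using (just; nothing)
import Data.Maybe.Base as Maybe
open import Data.Maybe.Properties using (just-injective)
open import Data.Nat.Base as ℕ using (ℕ; zero; suc)
import Data.Nat.Properties as ℕ
open import Data.Product.Base using (_×_; _,_; ∃-syntax; proj₁; proj₂)
open import Data.Sum.Base using (_⊎_; inj₁; inj₂)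
import Data.Vec.Functional as Vector
open import Data.Vec.Functional.Properties using (updateAt-updates; updateAt-minimal)
open import Data.Vec.Properties using ([]=⇒lookup; lookup⇒[]=; lookup∘tabulate)
open import Function.Base using (_∘_; const)
open import Function.Bundles using (mk⇔)
open import Relation.Binary.Bundles using (TotalOrder)
open import Relation.Binary.PropositionalEquality using (_≡_; _≢_; refl; sym; trans; cong; cong₂; subst; subst₂; module ≡-Reasoning)
open import Relation.Binary.Structures using (IsDecTotalOrder)
open import Relation.Nullary.Construct.Add.Supremum using (_⁺; ⊤⁺; [_]; ≡-dec)
open import Relation.Nullary.Decidable using (yes; no; does; dec-true; _×-dec_)
open import Relation.Nullary.Negation using (¬_; contradiction)

-- Ordered-field arithmetic, and affine maps compared with the identity.

module OrderedFieldProperties {a ℓ : Level} (K : OrderedField a ℓ) where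

  open OrderedField K

  commutativeRing : CommutativeRing a a
  commutativeRing = record { isCommutativeRing = isCommutativeRing }

  open CommutativeRing commutativeRing public
    using (ring; commutativeSemiring; +-comm; +-assoc; *-comm; *-assoc;
           +-identityˡ; +-identityʳ; *-identityˡ; *-identityʳ; zeroˡ; zeroʳ;
           -‿inverseˡ; -‿inverseʳ)
  open RingProperties ring public using (+-cancelˡ; +-cancelʳ)
  open SemiringSolver commutativeSemiring public using (solve; _:=_; _:+_; _:*_; con)

  open IsDecTotalOrder isDecTotalOrder public
    using (total; antisym; _≟_; _≤?_)
    renaming (refl to ≤-refl; trans to ≤-trans; reflexive to ≤-reflexive)

  <⇒≤ : ∀ {x y} → x < y → x ≤ y
  <⇒≤ = proj₁

  <⇒≱ : ∀ {x y} → x < y → ¬ y ≤ x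
  <⇒≱ (x≤y , x≢y) y≤x = x≢y (antisym x≤y y≤x)

  ≰⇒> : ∀ {x y} → ¬ x ≤ y → y < x
  ≰⇒> {x} {y} x≰y with total x y
  ... | inj₁ x≤y = contradiction x≤y x≰y
  ... | inj₂ y≤x = y≤x , λ { refl → x≰y ≤-refl }

  <-≤-trans : ∀ {x y z} → x < y → y ≤ z → x < z
  <-≤-trans x<y y≤z = ≤-trans (<⇒≤ x<y) y≤z , λ { refl → <⇒≱ x<y y≤z }

  x-y+y≡x : ∀ x y → x - y + y ≡ x
  x-y+y≡x x y = trans (+-assoc x (- y) y) (trans (cong (x +_) (-‿inverseˡ y)) (+-identityʳ x))

  +-monoʳ-≤ : ∀ z {x y} → x ≤ y → z + x ≤ z + y
  +-monoʳ-≤ z {x} {y} x≤y = subst₂ _≤_ (+-comm x z) (+-comm y z) (+-monoˡ-≤ z x≤y)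

  +-mono-≤ : ∀ {w x y z} → w ≤ x → y ≤ z → w + y ≤ x + z
  +-mono-≤ {x = x} {y} w≤x y≤z = ≤-trans (+-monoˡ-≤ y w≤x) (+-monoʳ-≤ x y≤z)

  +-cancelʳ-≤ : ∀ z {x y} → x + z ≤ y + z → x ≤ y
  +-cancelʳ-≤ z {x} {y} p = subst₂ _≤_ (lemma x) (lemma y) (+-monoˡ-≤ (- z) p)
    where
    lemma : ∀ w → w + z + - z ≡ w
    lemma w = trans (+-assoc w z (- z)) (trans (cong (w +_) (-‿inverseʳ z)) (+-identityʳ w))

  x≤x+t : ∀ x {t} → 0# ≤ t → x ≤ x + t
  x≤x+t x {t} 0≤t = subst (_≤ x + t) (+-identityʳ x) (+-monoʳ-≤ x 0≤t)

  -- Inequalities are unpacked into sums so that the remaining identities are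
  -- within reach of a solver for semirings.
  ≤⇒∃+ : ∀ {x y} → x ≤ y → ∃[ t ] 0# ≤ t × y ≡ x + t
  ≤⇒∃+ {x} {y} x≤y =
    y - x , subst (_≤ y - x) (-‿inverseʳ x) (+-monoˡ-≤ (- x) x≤y) ,
    sym (trans (+-comm x (y - x)) (x-y+y≡x y x))

  *-monoʳ-≤ : ∀ {z x y} → 0# ≤ z → x ≤ y → z * x ≤ z * y
  *-monoʳ-≤ {z} {x} 0≤z x≤y with ≤⇒∃+ x≤y
  ... | t , 0≤t , refl = subst (z * x ≤_)
    (solve 3 (λ z x t → z :* x :+ z :* t := z :* (x :+ t)) refl z x t)
    (x≤x+t (z * x) (*-nonNegative 0≤z 0≤t))

  0<1 : 0# < 1#
  0<1 with total 0# 1#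
  ... | inj₁ 0≤1 = 0≤1 , 0≢1
  ... | inj₂ 1≤0 with ≤⇒∃+ 1≤0
  ... | t , 0≤t , 0≡1+t = subst (0# ≤_) t*t≡1 (*-nonNegative 0≤t 0≤t) , 0≢1
    where
    -- 0 = (1 + t)t = t + t² and 0 = 1 + t
    t*t≡1 : t * t ≡ 1#
    t*t≡1 = +-cancelˡ t (t * t) 1# (begin
      t + t * t       ≡⟨ solve 1 (λ t → t :+ t :* t := (con 1 :+ t) :* t) refl t ⟩
      (1# + t) * t    ≡⟨ cong (_* t) (sym 0≡1+t) ⟩
      0# * t          ≡⟨ zeroˡ t ⟩
      0#              ≡⟨ 0≡1+t ⟩
      1# + t          ≡⟨ +-comm 1# t ⟩
      t + 1#          ∎)
      where open ≡-Reasoning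

  ÷-* : ∀ {x y} → y ≢ 0# → (x ÷ y) * y ≡ x
  ÷-* {x} {y} y≢0 = trans (*-assoc x (y ⁻¹) y)
    (trans (cong (x *_) (trans (*-comm (y ⁻¹) y) (⁻¹-inverseʳ y y≢0))) (*-identityʳ x))

  <⇒≢0 : ∀ {x} → 0# < x → x ≢ 0#
  <⇒≢0 (_ , 0≢x) x≡0 = 0≢x (sym x≡0)

  *-cancelˡ-≡ : ∀ {z x y} → z ≢ 0# → z * x ≡ z * y → x ≡ y
  *-cancelˡ-≡ {z} {x} {y} z≢0 zx≡zy = trans (sym (lemma x)) (trans (cong (_÷ z) zx≡zy) (lemma y))
    where
    lemma : ∀ w → z * w ÷ z ≡ w
    lemma w = trans (solve 3 (λ z w i → z :* w :* i := w :* (z :* i)) refl z w (z ⁻¹))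
      (trans (cong (w *_) (⁻¹-inverseʳ z z≢0)) (*-identityʳ w))

  *-cancelˡ-≤ : ∀ {z x y} → 0# < z → z * x ≤ z * y → x ≤ y
  *-cancelˡ-≤ {z} {x} {y} 0<z zx≤zy with total x y
  ... | inj₁ x≤y = x≤y
  ... | inj₂ y≤x = ≤-reflexive
    (*-cancelˡ-≡ (<⇒≢0 0<z) (antisym zx≤zy (*-monoʳ-≤ (<⇒≤ 0<z) y≤x)))

  *-pos : ∀ {x y} → 0# < x → 0# < y → 0# < x * y
  *-pos {x} {y} 0<x 0<y = *-nonNegative (<⇒≤ 0<x) (<⇒≤ 0<y) ,
    λ 0≡xy → proj₂ 0<y (*-cancelˡ-≡ (<⇒≢0 0<x) (trans (zeroʳ x) 0≡xy))

  affine-mono-≤ : ∀ c {γ x y} → 0# ≤ γ → x ≤ y → c + γ * x ≤ c + γ * y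
  affine-mono-≤ c 0≤γ x≤y = +-monoʳ-≤ c (*-monoʳ-≤ 0≤γ x≤y)

  -- The gap `c + γ * x - x` has slope `γ - 1`, here nonnegative, so once nonnegative it stays so
  -- further up. `contractive-↓` is the mirror image.
  expansive-↑ : ∀ {c γ x y} → 1# ≤ γ → x ≤ y → x ≤ c + γ * x → y ≤ c + γ * y
  expansive-↑ {c} {x = x} 1≤γ x≤y x≤ with ≤⇒∃+ 1≤γ | ≤⇒∃+ x≤y
  ... | s , 0≤s , refl | t , 0≤t , refl = ≤-trans (+-monoˡ-≤ t x≤)
    (subst (c + (1# + s) * x + t ≤_)
      (solve 4 (λ c s x t → c :+ (con 1 :+ s) :* x :+ t :+ s :* t
                          := c :+ (con 1 :+ s) :* (x :+ t)) refl c s x t)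
      (x≤x+t _ (*-nonNegative 0≤s 0≤t)))

  contractive-↓ : ∀ {c γ x y} → γ ≤ 1# → x ≤ y → y ≤ c + γ * y → x ≤ c + γ * x
  contractive-↓ {c} {γ} {x} γ≤1 x≤y y≤ with ≤⇒∃+ γ≤1 | ≤⇒∃+ x≤y
  ... | s , 0≤s , 1≡γ+s | t , 0≤t , refl = +-cancelʳ-≤ t (≤-trans y≤
    (subst (c + γ * (x + t) ≤_)
      (trans (solve 5 (λ c γ s x t → c :+ γ :* (x :+ t) :+ s :* t
                                  := c :+ γ :* x :+ (γ :+ s) :* t) refl c γ s x t)
             (cong (c + γ * x +_) (trans (cong (_* t) (sym 1≡γ+s)) (*-identityˡ t))))
      (x≤x+t _ (*-nonNegative 0≤s 0≤t))))

  -- The gap is affine, so it is nonnegative between two points where it is; the sign of its slope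
  -- decides which endpoint is used.
  segment : ∀ {c γ x y z} → x ≤ y → y ≤ z → x ≤ c + γ * x → z ≤ c + γ * z → y ≤ c + γ * y
  segment {γ = γ} x≤y y≤z x≤ z≤ with total 1# γ
  ... | inj₁ 1≤γ = expansive-↑ 1≤γ x≤y x≤
  ... | inj₂ γ≤1 = contractive-↓ γ≤1 y≤z z≤

  -- The tool that turns inequalities `z u ≤ c + γ * z u` into upper bounds on `z u`: for `γ < 1#`
  -- the gap is strictly decreasing, nonnegative at `x` and nonpositive at `y`.
  contractive-upper : ∀ {c γ x y} → γ < 1# → x ≤ c + γ * x → c + γ * y ≤ y → x ≤ y
  contractive-upper {c} {γ} {x} {y} γ<1 x≤ ≤y with ≤⇒∃+ (<⇒≤ γ<1)
  ... | s , 0≤s , 1≡γ+s = *-cancelˡ-≤ 0<s (+-cancelʳ-≤ (γ * x + γ * y)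
    (subst₂ _≤_ (lemma x (γ * y)) (trans (lemma y (γ * x)) (cong (s * y +_) (+-comm _ _)))
      (≤-trans (+-monoˡ-≤ (γ * y) x≤)
        (subst (_≤ y + γ * x)
          (solve 3 (λ c p q → c :+ q :+ p := c :+ p :+ q) refl c (γ * x) (γ * y))
          (+-monoˡ-≤ (γ * x) ≤y)))))
    where
    0<s : 0# < s
    0<s = 0≤s , λ 0≡s → proj₂ γ<1
      (trans (sym (+-identityʳ γ)) (trans (cong (γ +_) 0≡s) (sym 1≡γ+s)))
    lemma : ∀ w q → w + q ≡ s * w + (γ * w + q)
    lemma w q = trans (cong (λ k → k + q) (trans (sym (*-identityˡ w)) (cong (_* w) 1≡γ+s)))
      (solve 4 (λ γ s w q → (γ :+ s) :* w :+ q := s :* w :+ (γ :* w :+ q)) refl γ s w q)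

  expansive-of-potential : ∀ {γ d} → 0# < d → d ≤ γ * d → 1# ≤ γ
  expansive-of-potential {γ} {d} 0<d d≤γd = *-cancelˡ-≤ 0<d
    (subst₂ _≤_ (sym (*-identityʳ d)) (*-comm γ d) d≤γd)

  cycle-fixpoint : ∀ c {γ} → γ < 1# →
    let s = c ÷ (1# - γ) in c + γ * s ≡ s
  cycle-fixpoint c {γ} γ<1 = begin
    c + γ * s               ≡⟨ cong (_+ γ * s) (sym (÷-* 1-γ≢0)) ⟩
    s * (1# - γ) + γ * s    ≡⟨ solve 3 (λ s p γ → s :* p :+ γ :* s := s :* (p :+ γ)) refl s (1# - γ) γ ⟩
    s * (1# - γ + γ)        ≡⟨ cong (s *_) (x-y+y≡x 1# γ) ⟩
    s * 1#                  ≡⟨ *-identityʳ s ⟩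
    s                       ∎
    where
    open ≡-Reasoning
    s = c ÷ (1# - γ)
    1-γ≢0 : 1# - γ ≢ 0#
    1-γ≢0 eq = proj₂ γ<1 (trans (sym (+-identityˡ γ)) (trans (cong (_+ γ) (sym eq)) (x-y+y≡x 1# γ)))

  -- The Newton step from δ along the line t ↦ c + γ t, with g = γ - 1.
  newton-fixpoint : ∀ {b c γ g} δ → g ≢ 0# → g + 1# ≡ γ → b ≡ c + γ * δ →
    let δ₁ = δ - (b - δ) ÷ g in c + γ * δ₁ ≡ δ₁
  newton-fixpoint {b} {c} {γ} {g} δ g≢0 refl refl = +-cancelʳ (γ * q) _ _ (begin
    c + γ * δ₁ + γ * q      ≡⟨ solve 4 (λ c γ d q → c :+ γ :* d :+ γ :* q := c :+ γ :* (d :+ q)) refl c γ δ₁ q ⟩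
    c + γ * (δ₁ + q)        ≡⟨ cong (λ t → c + γ * t) (x-y+y≡x δ q) ⟩
    b                       ≡⟨ sym (x-y+y≡x b δ) ⟩
    b - δ + δ               ≡⟨ cong₂ _+_ (sym (÷-* g≢0)) (sym (x-y+y≡x δ q)) ⟩
    q * g + (δ₁ + q)        ≡⟨ solve 3 (λ q g d → q :* g :+ (d :+ q) := d :+ (g :+ con 1) :* q) refl q g δ₁ ⟩
    δ₁ + γ * q              ∎)
    where
    open ≡-Reasoning
    q  = (b - δ) ÷ g
    δ₁ = δ - q

  -- Serves to pick one multiple of the ray that is large enough for all arcs at once.
  common-upper : ∀ {p k} (P : Fin k → Carrier → Set p) →
    (∀ i {s t} → s ≤ t → P i s → P i t) →
    (∀ i → ∃[ t ] 0# ≤ t × P i t) → ∃[ t ] 0# ≤ t × (∀ i → P i t)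
  common-upper {k = zero}  P ↑ each = 0# , ≤-refl , λ ()
  common-upper {k = suc k} P ↑ each
    with each zero | common-upper (λ i → P (suc i)) (λ i → ↑ (suc i)) (λ i → each (suc i))
  ... | s , 0≤s , p₀ | t , 0≤t , ps with total s t
  ... | inj₁ s≤t = t , 0≤t , λ { zero → ↑ zero s≤t p₀ ; (suc i) → ps i }
  ... | inj₂ t≤s = s , 0≤s , λ { zero → p₀ ; (suc i) → ↑ (suc i) t≤s (ps i) }

  -- Serves to pick the label of `u` from which a new ray is computed. Values that are not positive
  -- are exempt, as the ray may vanish at the targets of some arcs.
  common-lower : ∀ {k} (f : Fin k → Carrier) →
    ∃[ ε ] 0# < ε × (∀ i → 0# < f i → ε ≤ f i)
  common-lower {zero}  f = 1# , 0<1 , λ ()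
  common-lower {suc k} f with common-lower (λ i → f (suc i)) | 0# ≤? f zero | f zero ≟ 0#
  ... | ε , 0<ε , ε≤ | no 0≰f | _ = ε , 0<ε , λ { zero 0<f → contradiction (<⇒≤ 0<f) 0≰f ; (suc i) → ε≤ i }
  ... | ε , 0<ε , ε≤ | yes _ | yes f≡0 = ε , 0<ε , λ { zero 0<f → contradiction f≡0 (<⇒≢0 0<f) ; (suc i) → ε≤ i }
  ... | ε , 0<ε , ε≤ | yes 0≤f | no f≢0 with total ε (f zero)
  ... | inj₁ ε≤f = ε , 0<ε , λ { zero _ → ε≤f ; (suc i) → ε≤ i }
  ... | inj₂ f≤ε = f zero , (0≤f , λ eq → f≢0 (sym eq)) ,
    λ { zero _ → ≤-refl ; (suc i) 0<f → ≤-trans f≤ε (ε≤ i 0<f) }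

  ray-reaches : ∀ {d} → 0# < d → ∀ x s → ∃[ t ] 0# ≤ t × s ≤ x + t * d
  ray-reaches {d} 0<d x s with total s x
  ... | inj₁ s≤x = 0# , ≤-refl , ≤-trans s≤x (x≤x+t x (*-nonNegative ≤-refl (<⇒≤ 0<d)))
  ... | inj₂ x≤s with ≤⇒∃+ x≤s
  ... | r , 0≤r , refl = r ÷ d ,
    *-cancelˡ-≤ 0<d (subst₂ _≤_ (sym (zeroʳ d)) (trans (sym (÷-* (<⇒≢0 0<d))) (*-comm _ d)) 0≤r) ,
    ≤-reflexive (cong (x +_) (sym (÷-* (<⇒≢0 0<d))))

-- Lists without repetitions in a finite type.

lookup-injective : ∀ {b} {B : Set b} {xs : List B} → Unique xs →
  ∀ {i j} → lookup xs i ≡ lookup xs j → i ≡ j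
lookup-injective (_ ∷ _)   {zero}  {zero}  _  = refl
lookup-injective (x∉ ∷ _)  {zero}  {suc j} eq = contradiction eq (All.lookup x∉ (∈-lookup j))
lookup-injective (x∉ ∷ _)  {suc i} {zero}  eq = contradiction (sym eq) (All.lookup x∉ (∈-lookup i))
lookup-injective (_ ∷ uxs) {suc i} {suc j} eq = cong suc (lookup-injective uxs eq)

Unique⇒length≤ : ∀ {n} {xs : List (Fin n)} → Unique xs → length xs ℕ.≤ n
Unique⇒length≤ uxs = Fin.injective⇒≤ (lookup-injective uxs)

-- Labels with an infinite value, and affine maps on them.

module ExtendedOrder {a ℓ : Level} (K : OrderedField a ℓ) where

  open OrderedField K
  open OrderedFieldProperties K
  open Algorithm K
  open import Relation.Binary.Construct.Add.Supremum.NonStrict _≤_ public using ([_]; _≤⊤⁺; [≤]-injective)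
  open import Relation.Binary.Construct.Add.Supremum.Strict _<_ public using ([_]; [_]<⊤⁺; [<]-injective)

  open TotalOrder ≤⁺-totalOrder public using ()
    renaming (refl to ≤⁺-refl; trans to ≤⁺-trans; reflexive to ≤⁺-reflexive; antisym to ≤⁺-antisym)

  <⁺⇒≱⁺ : ∀ {x y} → x <⁺ y → ¬ y ≤⁺ x
  <⁺⇒≱⁺ [ x<y ] [ y≤x ] = <⇒≱ x<y y≤x

  ≰⁺⇒>⁺ : ∀ {x y} → ¬ x ≤⁺ y → y <⁺ x
  ≰⁺⇒>⁺ {x}     {⊤⁺}    x≰y = contradiction (_ ≤⊤⁺) x≰y
  ≰⁺⇒>⁺ {⊤⁺}    {[ y ]} x≰y = [ y ]<⊤⁺
  ≰⁺⇒>⁺ {[ x ]} {[ y ]} x≰y = [ ≰⇒> (x≰y ∘ [_]) ]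

  ≮⁺⇒≥⁺ : ∀ {x y} → ¬ x <⁺ y → y ≤⁺ x
  ≮⁺⇒≥⁺ {⊤⁺}    {y}     x≮y = _ ≤⊤⁺
  ≮⁺⇒≥⁺ {[ x ]} {⊤⁺}    x≮y = contradiction [ x ]<⊤⁺ x≮y
  ≮⁺⇒≥⁺ {[ x ]} {[ y ]} x≮y with y ≤? x
  ... | yes y≤x = [ y≤x ]
  ... | no  y≰x = contradiction [ ≰⇒> y≰x ] x≮y

  <⁺-≤⁺-trans : ∀ {x y z} → x <⁺ y → y ≤⁺ z → x <⁺ z
  <⁺-≤⁺-trans x<y y≤z = ≰⁺⇒>⁺ (λ z≤x → <⁺⇒≱⁺ x<y (≤⁺-trans y≤z z≤x))

  ≤⁺-<⁺-trans : ∀ {x y z} → x ≤⁺ y → y <⁺ z → x <⁺ z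
  ≤⁺-<⁺-trans x≤y y<z = ≰⁺⇒>⁺ (λ z≤x → <⁺⇒≱⁺ y<z (≤⁺-trans z≤x x≤y))

  ⊤⁺≤⇒≡⊤⁺ : ∀ {x} → ⊤⁺ ≤⁺ x → x ≡ ⊤⁺
  ⊤⁺≤⇒≡⊤⁺ (_ ≤⊤⁺) = refl

  ≤[]⇒finite : ∀ {x r} → x ≤⁺ [ r ] → ∃[ s ] x ≡ [ s ]
  ≤[]⇒finite {[ s ]} _ = s , refl

  affine : Carrier → Carrier → Carrier ⁺ → Carrier ⁺
  affine c γ = Maybe.map (λ t → c + γ * t)

  affine-mono : ∀ {c γ x y} → 0# ≤ γ → x ≤⁺ y → affine c γ x ≤⁺ affine c γ y
  affine-mono {c} 0≤γ [ x≤y ]  = [ affine-mono-≤ c 0≤γ x≤y ]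
  affine-mono     0≤γ (_ ≤⊤⁺) = _ ≤⊤⁺

  affine-∘ : ∀ c γ c′ γ′ x → affine c γ (affine c′ γ′ x) ≡ affine (c + γ * c′) (γ * γ′) x
  affine-∘ c γ c′ γ′ ⊤⁺    = refl
  affine-∘ c γ c′ γ′ [ t ] = cong [_]
    (solve 5 (λ c γ c′ γ′ t → c :+ γ :* (c′ :+ γ′ :* t) := c :+ γ :* c′ :+ γ :* γ′ :* t) refl c γ c′ γ′ t)

  affine-id : ∀ x → affine 0# 1# x ≡ x
  affine-id ⊤⁺    = refl
  affine-id [ t ] = cong [_] (trans (+-identityˡ _) (*-identityˡ t))

-- Grapevine on an arbitrary system, and the walks behind its labels.

module WalkBounds {a ℓ : Level} (K : OrderedField a ℓ) where

  open OrderedField K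
  open OrderedFieldProperties K
  open Algorithm K
  open ExtendedOrder K
  private module Ext = Extrema ≤⁺-totalOrder

  module _ {N m : ℕ} (H : System N m) (A : Subset m) where
    open System H

    gain≥0 : ∀ e → 0# ≤ gain e
    gain≥0 e = <⇒≤ (gain>0 e)

    Valid : Labels N → Set (a ⊔ ℓ)
    Valid y = ∀ e → e ∈ A → y (src e) ≤⁺ arcBound H y e

    ¬violated⇒Valid : ∀ {y} → ¬ HasViolatedArc H A y → Valid y
    ¬violated⇒Valid ¬viol e e∈A = ≮⁺⇒≥⁺ (λ viol → ¬viol (e , e∈A , viol))

    arcBound-mono : ∀ {y y′} e → y (tgt e) ≤⁺ y′ (tgt e) → arcBound H y e ≤⁺ arcBound H y′ e
    arcBound-mono e = affine-mono (gain≥0 e)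

    arcBound-reflects-< : ∀ {y y′} e → arcBound H y e <⁺ arcBound H y′ e → y (tgt e) <⁺ y′ (tgt e)
    arcBound-reflects-< {y} {y′} e lt = ≰⁺⇒>⁺ (λ le → <⁺⇒≱⁺ lt (arcBound-mono {y′} {y} e le))

    ∈-outArcs : ∀ {e v} → e ∈ A → src e ≡ v → e ∈ₗ outArcs H A v
    ∈-outArcs {e} e∈A eq = ∈-filter⁺ _ (∈-allFin e) (e∈A , eq)

    minOut≤arc : ∀ y {e v} → e ∈ A → src e ≡ v → minOut H A y v ≤⁺ arcBound H y e
    minOut≤arc y {e} {v} e∈A eq =
      All.lookup (Ext.min≤xs ⊤⁺ (map (arcBound H y) (outArcs H A v))) (∈-map⁺ (arcBound H y) (∈-outArcs e∈A eq))

    ≤minOut : ∀ y {v x} → (∀ e → e ∈ A → src e ≡ v → x ≤⁺ arcBound H y e) → x ≤⁺ minOut H A y v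
    ≤minOut y {v} below = Ext.v≤min⁺ (_ ≤⊤⁺) (All.tabulate λ ∈map → helper (∈-map⁻ (arcBound H y) ∈map))
      where
      helper : ∀ {w} → (∃[ e ] e ∈ₗ outArcs H A v × w ≡ arcBound H y e) → _ ≤⁺ w
      helper (e , e∈ , refl) =
        let _ , e∈A , eq = ∈-filter⁻ (λ e → (e ∈? A) ×-dec (src e Fin.≟ v)) {xs = allFin m} e∈
        in below e e∈A eq

    relax≤ : ∀ y v → relax H A y v ≤⁺ y v
    relax≤ y v = Ext.min≤⊤ (y v) (map (arcBound H y) (outArcs H A v))

    relax≤arc : ∀ y {e v} → e ∈ A → src e ≡ v → relax H A y v ≤⁺ arcBound H y e
    relax≤arc y {e} {v} e∈A eq =
      All.lookup (Ext.min≤xs (y v) (map (arcBound H y) (outArcs H A v))) (∈-map⁺ (arcBound H y) (∈-outArcs e∈A eq))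

    relax-sel : ∀ y v → relax H A y v ≡ y v ⊎
                        ∃[ e ] e ∈ A × src e ≡ v × arcBound H y e ≡ relax H A y v
    relax-sel y v with Ext.argmin-sel (λ x → x) (y v) (map (arcBound H y) (outArcs H A v))
    ... | inj₁ eq = inj₁ eq
    ... | inj₂ ∈map =
      let e , e∈ , eq = ∈-map⁻ (arcBound H y) ∈map
          _ , e∈A , src≡ = ∈-filter⁻ (λ e → (e ∈? A) ×-dec (src e Fin.≟ v)) {xs = allFin m} e∈
      in inj₂ (e , e∈A , src≡ , sym eq)

    relax-induction : ∀ {p} (P : Fin N → Carrier ⁺ → Set p) {y} → (∀ v → P v (y v)) →
      (∀ {e} → e ∈ A → P (src e) (arcBound H y e)) → ∀ v → P v (relax H A y v)
    relax-induction P {y} Py Parc v with relax-sel y v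
    ... | inj₁ eq = subst (P v) (sym eq) (Py v)
    ... | inj₂ (e , e∈A , refl , eq) = subst (P v) eq (Parc e∈A)

    grapevine-≤ : ∀ i y v → grapevine H i A y v ≤⁺ y v
    grapevine-≤ zero    y v = ≤⁺-refl
    grapevine-≤ (suc i) y v = ≤⁺-trans (relax≤ (grapevine H i A y) v) (grapevine-≤ i y v)

    grapevine-antitone : ∀ {i j} y v → i ℕ.≤′ j → grapevine H j A y v ≤⁺ grapevine H i A y v
    grapevine-antitone y v ℕ.≤′-refl = ≤⁺-refl
    grapevine-antitone {j = suc j} y v (ℕ.≤′-step i≤j) =
      ≤⁺-trans (relax≤ (grapevine H j A y) v) (grapevine-antitone y v i≤j)

    Valid⇒≤grapevine : ∀ {x y} → Valid x → (∀ v → x v ≤⁺ y v) → ∀ i v → x v ≤⁺ grapevine H i A y v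
    Valid⇒≤grapevine         vx x≤y zero    = x≤y
    Valid⇒≤grapevine {x} {y} vx x≤y (suc i) = relax-induction (λ v t → x v ≤⁺ t) below
      (λ {e} e∈A → ≤⁺-trans (vx e e∈A) (arcBound-mono {x} {grapevine H i A y} e (below (tgt e))))
      where
      below : ∀ v → x v ≤⁺ grapevine H i A y v
      below = Valid⇒≤grapevine vx x≤y i

    walkBound : List (Fin m) → Carrier ⁺ → Carrier ⁺
    walkBound P = affine (walkCost H P) (walkGain H P)

    walkBound-∷ : ∀ y e P t → y (tgt e) ≡ walkBound P t → arcBound H y e ≡ walkBound (e ∷ P) t
    walkBound-∷ y e P t eq = trans (cong (affine (cost e) (gain e)) eq)
      (affine-∘ (cost e) (gain e) (walkCost H P) (walkGain H P) t)

    walkGain≥0 : ∀ P → 0# ≤ walkGain H P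
    walkGain≥0 []      = <⇒≤ 0<1
    walkGain≥0 (e ∷ P) = *-nonNegative (gain≥0 e) (walkGain≥0 P)

    walkBound-mono : ∀ P {x y} → x ≤⁺ y → walkBound P x ≤⁺ walkBound P y
    walkBound-mono P = affine-mono (walkGain≥0 P)

    Valid⇒≤walkBound : ∀ {y} → Valid y → ∀ {v t P} → IsWalk H A v t P → y v ≤⁺ walkBound P (y t)
    Valid⇒≤walkBound {y} vy {v} [] = ≤⁺-reflexive (sym (affine-id (y v)))
    Valid⇒≤walkBound {y} vy {t = t} {e ∷ P} (e∈A ∷ W) = ≤⁺-trans (vy e e∈A)
      (subst (arcBound H y e ≤⁺_) (affine-∘ _ _ _ _ (y t))
        (affine-mono {c = cost e} (gain≥0 e) (Valid⇒≤walkBound {y} vy W)))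

    module _ (y : Labels N) where

      private
        gv : ℕ → Labels N
        gv i = grapevine H i A y

      -- A relation in place of the function `trace`, so that it covers both the walks returned by
      -- the algorithm and walks built only for the proof.
      data Traced : ℕ → Fin N → Fin N → List (Fin m) → Set (a ⊔ ℓ) where
        start : ∀ {v} → Traced 0 v v []
        stay  : ∀ {i v t P} → gv (suc i) v ≡ gv i v → Traced i v t P → Traced (suc i) v t P
        step  : ∀ {i v t e P} → e ∈ A → src e ≡ v → gv (suc i) v <⁺ gv i v →
                arcBound H (gv i) e ≡ gv (suc i) v → Traced i (tgt e) t P →
                Traced (suc i) v t (e ∷ P)

      traced : ∀ i v → ∃[ t ] ∃[ P ] Traced i v t P
      traced zero    v = v , [] , start
      traced (suc i) v with relax-sel (gv i) v
      ... | inj₁ eq = let t , P , T = traced i v in t , P , stay eq T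
      ... | inj₂ (e , e∈A , src≡ , eq) with ≡-dec _≟_ (gv (suc i) v) (gv i v)
      ... | yes same = let t , P , T = traced i v in t , P , stay same T
      ... | no  diff = let t , P , T = traced i (tgt e) in
        t , e ∷ P , step e∈A src≡ (≰⁺⇒>⁺ (λ ge → diff (≤⁺-antisym (relax≤ (gv i) v) ge))) eq T

      GrapevineWalk⇒Traced : ∀ {i s P} → GrapevineWalk H i A y s P → Traced i s (walkEnd H s P) P
      GrapevineWalk⇒Traced (pred , rec , refl) = go _ _ rec
        where
        go : ∀ i s → (∀ j → j ℕ.< i → ∀ v → Recorded H A (gv j) v (pred j v)) →
             Traced i s (walkEnd H s (trace H pred i s)) (trace H pred i s)
        go zero    s rec = start
        go (suc i) s rec with pred i s | rec i ℕ.≤-refl s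
        ... | nothing | unchanged eq = stay eq (go i s (λ j j<i → rec j (ℕ.m<n⇒m<1+n j<i)))
        ... | just e  | decreased dec e∈A src≡ eq =
          step e∈A src≡ dec eq (go i (tgt e) (λ j j<i → rec j (ℕ.m<n⇒m<1+n j<i)))

      traced-walk : ∀ {i v t P} → Traced i v t P → IsWalk H A v t P
      traced-walk start                    = []
      traced-walk (stay _ T)               = traced-walk T
      traced-walk (step e∈A refl _ _ T) = e∈A ∷ traced-walk T

      traced-value : ∀ {i v t P} → Traced i v t P → gv i v ≡ walkBound P (y t)
      traced-value (start {v}) = sym (affine-id (y v))
      traced-value (stay eq T) = trans eq (traced-value T)
      traced-value (step {i} {t = t} {e} {P} _ _ _ eq T) =
        trans (sym eq) (walkBound-∷ (gv i) e P (y t) (traced-value T))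

      traced-decreases : ∀ {i v t e P} → Traced i v t (e ∷ P) → gv i v <⁺ y v
      traced-decreases (stay eq T)          = subst (_<⁺ _) (sym eq) (traced-decreases T)
      traced-decreases (step {i} {v} _ _ dec _ _) = <⁺-≤⁺-trans dec (grapevine-≤ i y v)

      -- Cutting the trace at its visit of `x` explains the label of `v` by the label that `x` had
      -- after round `j` instead of by an initial label. A revisit thus becomes a closed walk
      -- between two labels of the same node.
      traced-visit : ∀ {i v t P x} → Traced i v t P → x ∈ₗ map src P →
        ∃[ j ] ∃[ Q ] j ℕ.≤′ i × IsWalk H A v x Q × gv i v ≡ walkBound Q (gv j x)
      traced-visit (stay eq T) x∈ =
        let j , Q , j≤i , W , val = traced-visit T x∈ in j , Q , ℕ.≤′-step j≤i , W , trans eq val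
      traced-visit (step {i} _ refl _ _ _) (here refl) =
        suc i , [] , ℕ.≤′-refl , [] , sym (affine-id _)
      traced-visit {x = x} (step {i} {e = e} e∈A refl _ eq T) (there x∈) =
        let j , Q , j≤i , W , val = traced-visit T x∈
        in j , e ∷ Q , ℕ.≤′-step j≤i , e∈A ∷ W , trans (sym eq) (walkBound-∷ (gv i) e Q (gv j x) val)

      NoImprovingCycle : Set (a ⊔ ℓ)
      NoImprovingCycle = ∀ j {v e Q} → IsWalk H A v v (e ∷ Q) → gv j v ≤⁺ walkBound (e ∷ Q) (gv j v)

      -- Revisiting v after a round would have lowered the label of v along a
      -- closed walk.
      traced-unique : NoImprovingCycle → ∀ {i v t P} → Traced i v t P → Unique (map src P)
      traced-unique nic start      = []
      traced-unique nic (stay _ T) = traced-unique nic T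
      traced-unique nic (step {i} {v} {e = e} e∈A refl dec eq T) =
        ¬Any⇒All¬ _ revisit ∷ traced-unique nic T
        where
        revisit : ¬ (v ∈ₗ map src _)
        revisit v∈ =
          let j , Q , j≤i , W , val = traced-visit T v∈
          in <⁺⇒≱⁺ dec (≤⁺-trans (grapevine-antitone y v j≤i)
               (subst (gv j v ≤⁺_) (trans (sym (walkBound-∷ (gv i) e Q (gv j v) val)) eq) (nic j (e∈A ∷ W))))

      -- If `v` decreases in a round, its recorded arc offers less than it did one round before, so
      -- the target of the arc decreased in that earlier round. Going back, no round is skipped.
      traced-length : ∀ {i v t P} → gv (suc i) v <⁺ gv i v → Traced (suc i) v t P → length P ≡ suc i
      traced-length dec (stay eq _) = contradiction (≤⁺-reflexive (sym eq)) (<⁺⇒≱⁺ dec)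
      traced-length {zero}  _ (step _ _ _ _ start) = refl
      traced-length {suc i} _ (step {e = e} e∈A src≡ dec eq T) = cong suc (traced-length
        (arcBound-reflects-< {gv (suc i)} {gv i} e
          (subst (_<⁺ arcBound H (gv i) e) (sym eq)
            (<⁺-≤⁺-trans dec (relax≤arc (gv i) e∈A src≡)))) T)

      -- An arc violated after `i` rounds makes its source decrease in the next one.
      violated⇒long-trace : ∀ {i} → HasViolatedArc H A (gv i) →
        ∃[ v ] ∃[ t ] ∃[ P ] Traced (suc i) v t P × length P ≡ suc i
      violated⇒long-trace {i} (e , e∈A , viol) =
        let t , P , T = traced (suc i) (src e)
        in src e , t , P , T , traced-length (≤⁺-<⁺-trans (relax≤arc (gv i) e∈A refl) viol) T

-- The split graph `Gᵤ` and its relation to `G`.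

module SplitGraph {a ℓ : Level} (K : OrderedField a ℓ) {n m : ℕ}
  (G : Algorithm.System K n m) (A : Subset m) (u : Fin n) where

  open OrderedField K
  open OrderedFieldProperties K
  open Algorithm K
  open ExtendedOrder K
  open WalkBounds K
  open System G
  open NewtonDinkelbach G A u public

  Solution : (Fin n → Carrier) → Set (a ⊔ ℓ)
  Solution z = Valid G A ([_] ∘ z)

  diagonal : ∀ {b} {B : Set b} → (Fin n → B) → Fin (suc n) → B
  diagonal y = y u Vector.∷ y

  arcBound-unsplit : ∀ {ȳ} → ȳ zero ≡ ȳ (suc u) → ∀ e → arcBound Gᵤ ȳ e ≡ arcBound G (ȳ ∘ suc) e
  arcBound-unsplit {ȳ} eq e with tgt e Fin.≟ u
  ... | yes refl = cong (affine (cost e) (gain e)) eq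
  ... | no  _    = refl

  Valid-unsplit : ∀ {ȳ} → ȳ zero ≡ ȳ (suc u) → Valid Gᵤ A ȳ → Valid G A (ȳ ∘ suc)
  Valid-unsplit {ȳ} eq vȳ e e∈A = subst (ȳ (suc (src e)) ≤⁺_) (arcBound-unsplit {ȳ} eq e) (vȳ e e∈A)

  diagonalSolution : ∀ {z} → Solution z → Valid Gᵤ A ([_] ∘ diagonal z)
  diagonalSolution {z} sol e e∈A =
    subst ([ z (src e) ] ≤⁺_) (sym (arcBound-unsplit {[_] ∘ diagonal z} refl e)) (sol e e∈A)

  tgt≢u : ∀ e → System.tgt Gᵤ e ≢ suc u
  tgt≢u e eq with tgt e Fin.≟ u
  tgt≢u e ()   | yes _
  tgt≢u e refl | no u≢u = u≢u refl

  ends-≢u : ∀ {x t e P} → IsWalk Gᵤ A x t (e ∷ P) → t ≢ suc u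
  ends-≢u {e = e} {P = []} (_ ∷ W) refl = tgt≢u e (nil W)
    where
    nil : ∀ {x t} → IsWalk Gᵤ A x t [] → x ≡ t
    nil [] = refl
  ends-≢u {P = _ ∷ _} (_ ∷ W) eq = ends-≢u W eq

  no-return : ∀ {x e P} → ¬ IsWalk Gᵤ A x (suc u) (e ∷ P)
  no-return W = ends-≢u W refl

  sink-fixed : ∀ i ȳ → grapevine Gᵤ i A ȳ zero ≡ ȳ zero
  sink-fixed zero    ȳ = refl
  sink-fixed (suc i) ȳ with relax-sel Gᵤ A (grapevine Gᵤ i A ȳ) zero
  ... | inj₁ eq = trans eq (sink-fixed i ȳ)
  ... | inj₂ (_ , _ , () , _)

  splitLabels-u : ∀ y δ → splitLabels G y u δ (suc u) ≡ [ δ ]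
  splitLabels-u y δ = updateAt-updates u y

  splitLabels-≢u : ∀ y δ {v} → v ≢ u → splitLabels G y u δ (suc v) ≡ y v
  splitLabels-≢u y δ {v} v≢u = updateAt-minimal v u y v≢u

  -- Grapevine within a phase, between the solutions and an envelope.

  module Envelope (y : Labels n)
    (valid : ∀ e → e ∈ A → src e ≢ u → y (src e) ≤⁺ arcBound G y e)
    (nonAbsorbing : ∀ {v C} → v ≢ u → y v ≡ ⊤⁺ → IsWalk Gᵤ A (suc v) (suc v) C → 1# ≤ walkGain Gᵤ C)
    where

    unsunk : Labels (suc n)
    unsunk = ⊤⁺ Vector.∷ y

    -- Bounds from above every labelling that Grapevine meets in this phase.
    envelope : Labels (suc n)
    envelope zero = ⊤⁺
    envelope (suc v) with v Fin.≟ u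
    ... | yes _ = minOut Gᵤ A unsunk (suc u)
    ... | no  _ = y v

    envelope-u : envelope (suc u) ≡ minOut Gᵤ A unsunk (suc u)
    envelope-u with u Fin.≟ u
    ... | yes _  = refl
    ... | no u≢u = contradiction refl u≢u

    envelope-≢u : ∀ {v} → v ≢ u → envelope (suc v) ≡ y v
    envelope-≢u {v} v≢u with v Fin.≟ u
    ... | yes v≡u = contradiction v≡u v≢u
    ... | no  _   = refl

    arcBound-unsunk : ∀ e → arcBound G y e ≤⁺ arcBound Gᵤ unsunk e
    arcBound-unsunk e with tgt e Fin.≟ u
    ... | yes _ = _ ≤⊤⁺
    ... | no  _ = ≤⁺-refl

    arcBound-envelope : ∀ e → arcBound Gᵤ envelope e ≡ arcBound Gᵤ unsunk e
    arcBound-envelope e with tgt e Fin.≟ u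
    ... | yes _      = refl
    ... | no  tgt≢u = cong (affine (cost e) (gain e)) (envelope-≢u tgt≢u)

    -- At `u` the envelope is the minimum over the outgoing arcs; elsewhere validity is inherited
    -- from `y`, and the value `⊤⁺` at the sink only weakens the arcs that end there.
    envelope-valid : Valid Gᵤ A envelope
    envelope-valid e e∈A = subst (envelope (suc (src e)) ≤⁺_) (sym (arcBound-envelope e)) (go (src e Fin.≟ u))
      where
      go : _ → envelope (suc (src e)) ≤⁺ arcBound Gᵤ unsunk e
      go (yes src≡u) rewrite src≡u | envelope-u = minOut≤arc Gᵤ A unsunk e∈A (cong suc src≡u)
      go (no  src≢u) rewrite envelope-≢u src≢u = ≤⁺-trans (valid e e∈A src≢u) (arcBound-unsunk e)

    Below : Labels (suc n) → Set (a ⊔ ℓ)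
    Below ȳ = ∀ v → ȳ (suc v) ≤⁺ envelope (suc v)

    Below-splitLabels : ∀ {δ} → [ δ ] ≤⁺ envelope (suc u) → Below (splitLabels G y u δ)
    Below-splitLabels {δ} δ≤ v with v Fin.≟ u
    ... | no  v≢u  = ≤⁺-reflexive (splitLabels-≢u y δ v≢u)
    ... | yes refl = ≤⁺-trans (≤⁺-reflexive (splitLabels-u y δ)) (≤⁺-trans δ≤ (≤⁺-reflexive envelope-u))

    Below-grapevine : ∀ i {ȳ} → Below ȳ → Below (grapevine Gᵤ i A ȳ)
    Below-grapevine i {ȳ} ȳ≤ v = ≤⁺-trans (grapevine-≤ Gᵤ A i ȳ (suc v)) (ȳ≤ v)

    Above : (Fin n → Carrier) → Labels (suc n) → Set (a ⊔ ℓ)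
    Above z ȳ = ∀ x → [ diagonal z x ] ≤⁺ ȳ x

    Above-grapevine : ∀ i {z ȳ} → Solution z → Above z ȳ → Above z (grapevine Gᵤ i A ȳ)
    Above-grapevine i {z} sol = λ z≤ȳ → Valid⇒≤grapevine Gᵤ A {[_] ∘ diagonal z} (diagonalSolution sol) z≤ȳ i

    Above-splitLabels : ∀ {z δ} → (∀ v → [ z v ] ≤⁺ y v) → z u ≤ δ → Above z (splitLabels G y u δ)
    Above-splitLabels z≤y zu≤δ zero = [ zu≤δ ]
    Above-splitLabels {z} {δ} z≤y zu≤δ (suc v) with v Fin.≟ u
    ... | yes refl = subst ([ z u ] ≤⁺_) (sym (splitLabels-u y δ)) [ zu≤δ ]
    ... | no  v≢u  = subst ([ z v ] ≤⁺_) (sym (splitLabels-≢u y δ v≢u)) (z≤y v)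

    -- For finite `r` this is `segment` for the affine map of the walk. For `r ≡ ⊤⁺` there is no
    -- upper endpoint, and a gain of at least 1 takes its place: the gap does not shrink above `z`.
    walkBound-between : ∀ P r {b z} → [ z ] ≤⁺ [ b ] → [ b ] ≤⁺ r →
      [ z ] ≤⁺ walkBound Gᵤ A P [ z ] → r ≤⁺ walkBound Gᵤ A P r →
      (r ≡ ⊤⁺ → 1# ≤ walkGain Gᵤ P) → [ b ] ≤⁺ walkBound Gᵤ A P [ b ]
    walkBound-between P ⊤⁺    [ z≤b ] _       [ z≤ ] _      expansive = [ expansive-↑ (expansive refl) z≤b z≤ ]
    walkBound-between P [ r ] [ z≤b ] [ b≤r ] [ z≤ ] [ r≤ ] _         = [ segment z≤b b≤r z≤ r≤ ]

    -- The change of a label along a closed walk is affine in the label and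
    -- nonnegative at the solution and at the envelope.
    noImprovingCycle : ∀ {z ȳ} → Solution z → Above z ȳ → Below ȳ → NoImprovingCycle Gᵤ A ȳ
    noImprovingCycle {z} {ȳ} sol z≤ȳ ȳ≤ j {suc v} {e} {Q} W with v Fin.≟ u
    ... | yes refl = contradiction W no-return
    ... | no  v≢u with grapevine Gᵤ j A ȳ (suc v) in eq
    ... | ⊤⁺    = _ ≤⊤⁺
    ... | [ b ] = walkBound-between (e ∷ Q) (y v)
      (subst ([ z v ] ≤⁺_) eq (Above-grapevine j sol z≤ȳ (suc v)))
      (subst₂ _≤⁺_ eq (envelope-≢u v≢u) (Below-grapevine j {ȳ} ȳ≤ v))
      (Valid⇒≤walkBound Gᵤ A {[_] ∘ diagonal z} (diagonalSolution sol) W)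
      (subst (λ r → r ≤⁺ walkBound Gᵤ A (e ∷ Q) r) (envelope-≢u v≢u) (Valid⇒≤walkBound Gᵤ A {envelope} envelope-valid W))
      (λ y≡⊤ → nonAbsorbing v≢u y≡⊤ W)

    traced-unique-src : ∀ {z ȳ} → Solution z → Above z ȳ → Below ȳ →
      ∀ {i x t P} → Traced Gᵤ A ȳ i x t P → Unique (map src P)
    traced-unique-src {ȳ = ȳ} sol z≤ȳ ȳ≤ {P = P} T = Unique.map⁻ {f = suc}
      (subst Unique (map-∘ P) (traced-unique Gᵤ A ȳ (noImprovingCycle sol z≤ȳ ȳ≤) T))

    -- A violated arc after `n` rounds would give a trace of `n + 1` arcs with distinct sources. The
    -- sink is never a source, so only `n` are available although `Gᵤ` has `n + 1` nodes.
    converged : ∀ {z ȳ} → Solution z → Above z ȳ → Below ȳ →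
      ¬ HasViolatedArc Gᵤ A (grapevine Gᵤ n A ȳ)
    converged {ȳ = ȳ} sol z≤ȳ ȳ≤ viol =
      let _ , _ , P , T , len = violated⇒long-trace Gᵤ A ȳ viol
      in ℕ.1+n≰n (subst (ℕ._≤ n) (trans (length-map src P) len)
           (Unique⇒length≤ (traced-unique-src sol z≤ȳ ȳ≤ T)))

    -- No nonempty walk ends at `u`, which no arc of `Gᵤ` enters, and the empty one leaves the label
    -- at `δ`. A walk to another node of `V` starts from a label of the envelope, whose validity
    -- keeps the result at or above `δ`.
    ends-at-sink : ∀ {δ} → [ δ ] ≤⁺ envelope (suc u) → let ȳ = splitLabels G y u δ in
      ∀ {i t P} → Traced Gᵤ A ȳ i (suc u) t P → grapevine Gᵤ i A ȳ (suc u) <⁺ [ δ ] → t ≡ zero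
    ends-at-sink δ≤ {t = zero} T dec = refl
    ends-at-sink {δ} δ≤ {t = suc v} {P} T dec with v Fin.≟ u | traced-walk Gᵤ A _ T
    ... | yes refl | []        = contradiction
      (≤⁺-reflexive (sym (trans (traced-value Gᵤ A _ T) (trans (affine-id _) (splitLabels-u y δ)))))
      (<⁺⇒≱⁺ dec)
    ... | yes refl | e∈A ∷ W   = contradiction (e∈A ∷ W) no-return
    ... | no  v≢u  | W         = contradiction
      (≤⁺-trans δ≤ (≤⁺-trans (Valid⇒≤walkBound Gᵤ A {envelope} envelope-valid W)
        (≤⁺-reflexive (sym (trans (traced-value Gᵤ A _ T)
          (cong (walkBound Gᵤ A P) (trans (splitLabels-≢u y δ v≢u) (sym (envelope-≢u v≢u)))))))))
      (<⁺⇒≱⁺ dec)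

    -- The line t ↦ intercept + slope * t supports t ↦ f t + t at δ from above;
    -- tight says this for the labellings computed later in the phase.
    record Cut (ȳ : Labels (suc n)) (b g δ : Carrier) : Set (a ⊔ ℓ) where
      field
        slope intercept : Carrier
        slope≡ : g + 1# ≡ slope
        value≡ : b ≡ intercept + slope * δ
        sound  : ∀ {z} → Solution z → z u ≤ intercept + slope * z u
        tight  : ∀ {ȳ′} → Valid Gᵤ A ȳ′ → ȳ′ (suc u) ≤⁺ ȳ (suc u) →
                 ȳ′ (suc u) ≤⁺ affine intercept slope (ȳ′ zero)

    -- With `u′` and `u` identified, a walk from `u` to the sink is closed, so its bound relates
    -- `z u` to itself.
    sinkCut : ∀ {ȳ s i b δ P} → s zero ≡ [ δ ] → Traced Gᵤ A s i (suc u) zero P →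
      grapevine Gᵤ i A s (suc u) ≡ [ b ] → Cut ȳ b (walkGain Gᵤ P - 1#) δ
    sinkCut {s = s} {P = P} s₀ T eq = record
      { slope     = walkGain Gᵤ P
      ; intercept = walkCost Gᵤ P
      ; slope≡    = x-y+y≡x _ 1#
      ; value≡    = just-injective (trans (sym eq) (trans (traced-value Gᵤ A s T) (cong (walkBound Gᵤ A P) s₀)))
      ; sound     = λ {z} sol → [≤]-injective (Valid⇒≤walkBound Gᵤ A {[_] ∘ diagonal z} (diagonalSolution sol) W)
      ; tight     = λ {ȳ′} vȳ′ _ → Valid⇒≤walkBound Gᵤ A {ȳ′} vȳ′ W
      }
      where
      W = traced-walk Gᵤ A s T

    -- Serves walks that end elsewhere than the sink: their bound does not depend on `δ`, whence
    -- slope 0 and supergradient `- 1#`. It persists for later labels of the phase because the label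
    -- of `u` only decreases.
    constantCut : ∀ {ȳ b δ} → (∀ {z} → Solution z → z u ≤ b) → ȳ (suc u) ≤⁺ [ b ] → Cut ȳ b (- 1#) δ
    constantCut {b = b} {δ} z≤b ȳu≤b = record
      { slope     = 0#
      ; intercept = b
      ; slope≡    = -‿inverseˡ 1#
      ; value≡    = const≡ δ
      ; sound     = λ {z} sol → subst (z u ≤_) (const≡ (z u)) (z≤b sol)
      ; tight     = λ {ȳ′} _ le → ≤⁺-trans (≤⁺-trans le ȳu≤b) (tight′ (ȳ′ zero))
      }
      where
      const≡ : ∀ t → b ≡ b + 0# * t
      const≡ t = sym (trans (cong (b +_) (zeroˡ t)) (+-identityʳ b))
      tight′ : ∀ t → [ b ] ≤⁺ affine b 0# t
      tight′ ⊤⁺    = _ ≤⊤⁺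
      tight′ [ t ] = [ ≤-reflexive (const≡ t) ]

    -- Correctness of the look-ahead Newton-Dinkelbach iteration.

    Dominates : Labels (suc n) → Set (a ⊔ ℓ)
    Dominates ȳ = ∀ {z} → Solution z → Above z ȳ

    record Iterate (δ f : Carrier) (ȳ : Labels (suc n)) (b : Carrier) : Set (a ⊔ ℓ) where
      field
        label-u    : ȳ (suc u) ≡ [ b ]
        label-sink : ȳ zero ≡ [ δ ]
        f≡         : f ≡ b - δ
        isValid    : Valid Gᵤ A ȳ
        below      : Below ȳ

    module _ {ȳ : Labels (suc n)} (dom : Dominates ȳ) {δ : Carrier} where

      setSink-Above : ∀ {z} → Solution z → z u ≤ δ → Above z (setSink δ ȳ)
      setSink-Above sol zu≤δ zero    = [ zu≤δ ]
      setSink-Above sol zu≤δ (suc v) = dom sol (suc v)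

      grapevine-Dominates : (∀ {z} → Solution z → z u ≤ δ) → Dominates (grapevine Gᵤ n A (setSink δ ȳ))
      grapevine-Dominates ub sol = Above-grapevine n sol (setSink-Above sol (ub sol))

      -- Domination is promised only if `δ` bounds the solutions, since for a look-ahead point this
      -- bound is derived from the cut of the same call. There is no circle: the cut uses `dom` only
      -- at nodes of `V`, whose labels do not change when the sink is set to `δ`.
      oracle-Iterate : ∀ {f g ȳ₁} → Below ȳ → Oracle ȳ δ (value f g ȳ₁) →
        ∃[ b ] Iterate δ f ȳ₁ b × Cut ȳ₁ b g δ × ȳ₁ (suc u) ≤⁺ ȳ (suc u) ×
          ((∀ {z} → Solution z → z u ≤ δ) → Dominates ȳ₁)
      oracle-Iterate below (finite {P} {b} ¬viol gw label-u) =
        b ,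
        record
          { label-u    = label-u
          ; label-sink = sink-fixed n (setSink δ ȳ)
          ; f≡         = refl
          ; isValid    = ¬violated⇒Valid Gᵤ A {grapevine Gᵤ n A (setSink δ ȳ)} ¬viol
          ; below      = Below-grapevine n {setSink δ ȳ} below
          } ,
        cut (walkEnd Gᵤ (suc u) P) refl (GrapevineWalk⇒Traced Gᵤ A _ gw) ,
        grapevine-≤ Gᵤ A n (setSink δ ȳ) (suc u) ,
        grapevine-Dominates
        where
        cut : ∀ t → walkEnd Gᵤ (suc u) P ≡ t → Traced Gᵤ A (setSink δ ȳ) n (suc u) t P →
          Cut (grapevine Gᵤ n A (setSink δ ȳ)) b (supergradient P) δ
        cut zero eq T rewrite eq = sinkCut refl T label-u
        cut (suc v) eq T rewrite eq = constantCut
          (λ {z} sol → [≤]-injective (≤⁺-trans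
            (Valid⇒≤walkBound Gᵤ A {[_] ∘ diagonal z} (diagonalSolution sol) (traced-walk Gᵤ A _ T))
            (≤⁺-trans (walkBound-mono Gᵤ A P (dom sol (suc v)))
              (≤⁺-reflexive (trans (sym (traced-value Gᵤ A _ T)) label-u)))))
          (≤⁺-reflexive label-u)

    -- At a root the supergradient need not be negative, as the walk may be empty. Elsewhere the
    -- next step divides by `g` and takes its bound on the solutions from the cut.
    Descending : Labels (suc n) → (b δ f g : Carrier) → Set (a ⊔ ℓ)
    Descending ȳ b δ f g = f ≡ 0# ⊎ (g < 0# × Cut ȳ b g δ)

    <0⇒slope<1 : ∀ {g γ} → g < 0# → g + 1# ≡ γ → γ < 1#
    <0⇒slope<1 {g} g<0 refl = subst (g + 1# ≤_) (+-identityˡ 1#) (+-monoˡ-≤ 1# (<⇒≤ g<0)) ,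
      λ eq → proj₂ g<0 (+-cancelʳ 1# g 0# (trans eq (sym (+-identityˡ 1#))))

    0≤⇒1≤slope : ∀ {g γ} → 0# ≤ g → g + 1# ≡ γ → 1# ≤ γ
    0≤⇒1≤slope {g} 0≤g refl = subst (_≤ g + 1#) (+-identityˡ 1#) (+-monoˡ-≤ 1# 0≤g)

    b-δ<0⇒b<δ : ∀ {f b δ} → f ≡ b - δ → f < 0# → b < δ
    b-δ<0⇒b<δ {b = b} {δ} refl f<0 =
      subst₂ _≤_ (x-y+y≡x b δ) (+-identityˡ δ) (+-monoˡ-≤ δ (<⇒≤ f<0)) ,
      λ { refl → proj₂ f<0 (-‿inverseʳ δ) }

    b≤δ⇒f≤0 : ∀ {f b δ} → f ≡ b - δ → b ≤ δ → f ≤ 0#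
    b≤δ⇒f≤0 {b = b} {δ} refl b≤δ = subst (b - δ ≤_) (-‿inverseʳ δ) (+-monoˡ-≤ (- δ) b≤δ)

    -- A slope of at least 1 carries the inequality of the cut from `z u` up to `δ`, where it reads
    -- `δ ≤ b`.
    cut-contradiction : ∀ {ȳ b g δ} → (c : Cut ȳ b g δ) → 1# ≤ Cut.slope c → b < δ →
      ∀ {z} → Solution z → ¬ z u ≤ δ
    cut-contradiction c 1≤γ b<δ sol zu≤δ =
      <⇒≱ b<δ (subst (_ ≤_) (sym (Cut.value≡ c)) (expansive-↑ 1≤γ zu≤δ (Cut.sound c sol)))

    module NewtonStep {δ f g ȳ b} (it : Iterate δ f ȳ b) (g<0 : g < 0#) (c : Cut ȳ b g δ) where

      private
        δ₁ = newtonPoint δ f g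

      fixpoint : Cut.intercept c + Cut.slope c * δ₁ ≡ δ₁
      fixpoint = subst (λ f → let δ₁ = δ - f ÷ g in Cut.intercept c + Cut.slope c * δ₁ ≡ δ₁) (sym (Iterate.f≡ it))
        (newton-fixpoint δ (proj₂ g<0) (Cut.slope≡ c) (Cut.value≡ c))

      upper : ∀ {z} → Solution z → z u ≤ δ₁
      upper sol = contractive-upper (<0⇒slope<1 g<0 (Cut.slope≡ c)) (Cut.sound c sol) (≤-reflexive fixpoint)

      -- The labels at `δ₁` still obey the previous cut, whose line has `δ₁` as its fixed point.
      value≤0 : ∀ {f₁ ȳ₁ b₁} → Iterate δ₁ f₁ ȳ₁ b₁ → ȳ₁ (suc u) ≤⁺ ȳ (suc u) → f₁ ≤ 0#
      value≤0 {ȳ₁ = ȳ₁} {b₁} it₁ le = b≤δ⇒f≤0 (Iterate.f≡ it₁) (subst (b₁ ≤_) fixpoint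
        ([≤]-injective (subst₂ (λ p q → p ≤⁺ affine (Cut.intercept c) (Cut.slope c) q)
          (Iterate.label-u it₁) (Iterate.label-sink it₁) (Cut.tight c {ȳ₁} (Iterate.isValid it₁) le))))

    descending : ∀ {ȳ b δ f g} → f ≤ 0# → ¬ CertifiesNoRoot (value f g ȳ) → Cut ȳ b g δ → Descending ȳ b δ f g
    descending {f = f} {g} f≤0 ¬cert c with f ≟ 0# | 0# ≤? g
    ... | yes f≡0 | _       = inj₁ f≡0
    ... | no  f≢0 | yes 0≤g = contradiction (negative (f≤0 , f≢0) 0≤g) ¬cert
    ... | no  f≢0 | no  0≰g = inj₂ (≰⇒> 0≰g , c)

    record IsRoot (δ : Carrier) (ȳ : Labels (suc n)) : Set (a ⊔ ℓ) where
      field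
        label-u    : ȳ (suc u) ≡ [ δ ]
        label-sink : ȳ zero ≡ [ δ ]
        isValid    : Valid Gᵤ A ȳ
        below      : Below ȳ
        dominates  : Dominates ȳ

    Correct : Result → Set (a ⊔ ℓ)
    Correct (root δ ȳ) = IsRoot δ ȳ
    Correct noRoot     = ∀ z → ¬ Solution z

    newton-correct : ∀ {δ f g ȳ b r} → Newton δ f g ȳ r → Iterate δ f ȳ b → Dominates ȳ →
      Descending ȳ b δ f g → Correct r
    newton-correct {δ} {b = b} (stop refl) it dom _ = record
      { label-u    = trans (Iterate.label-u it) (cong [_] b≡δ)
      ; label-sink = Iterate.label-sink it
      ; isValid    = Iterate.isValid it
      ; below      = Iterate.below it
      ; dominates  = dom
      }
      where
      b≡δ : b ≡ δ
      b≡δ = trans (sym (x-y+y≡x b δ)) (trans (cong (_+ δ) (sym (Iterate.f≡ it))) (+-identityˡ δ))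
    newton-correct (fail f≢0 _ _)           _ _ (inj₁ f≡0) = contradiction f≡0 f≢0
    newton-correct (accept f≢0 _ _ _ _ _)   _ _ (inj₁ f≡0) = contradiction f≡0 f≢0
    newton-correct (reject f≢0 _ _ _ _ _)   _ _ (inj₁ f≡0) = contradiction f≡0 f≢0
    newton-correct (fail _ (violated viol) -∞) it dom (inj₂ (g<0 , c)) z sol =
      converged {z} sol (setSink-Above dom sol (NewtonStep.upper it g<0 c {z} sol)) (Iterate.below it) viol
    newton-correct (fail _ oracle (negative f₁<0 0≤g₁)) it dom (inj₂ (g<0 , c)) z sol =
      let b₁ , it₁ , c₁ , _ , _ = oracle-Iterate dom (Iterate.below it) oracle
      in cut-contradiction c₁ (0≤⇒1≤slope 0≤g₁ (Cut.slope≡ c₁)) (b-δ<0⇒b<δ (Iterate.f≡ it₁) f₁<0)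
           {z} sol (NewtonStep.upper it g<0 c {z} sol)
    newton-correct (accept _ oracle₁ _ oracle₂ (acceptable f₂<0 g₂<0) rest) it dom (inj₂ (g<0 , c)) =
      let b₁ , it₁ , _ , _ , dom₁ = oracle-Iterate dom (Iterate.below it) oracle₁
          b₂ , it₂ , c₂ , _ , dom₂ = oracle-Iterate (dom₁ (NewtonStep.upper it g<0 c)) (Iterate.below it₁) oracle₂
          b₂<δ₂ = b-δ<0⇒b<δ (Iterate.f≡ it₂) f₂<0
      in newton-correct rest it₂
           -- At `δ₂` the line of `c₂` lies below the identity and its slope is below 1, so `δ₂` is
           -- above its fixed point and hence above `z u`.
           (dom₂ λ sol → contractive-upper (<0⇒slope<1 g₂<0 (Cut.slope≡ c₂)) (Cut.sound c₂ sol)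
                           (subst (_≤ _) (Cut.value≡ c₂) (<⇒≤ b₂<δ₂)))
           (inj₂ (g₂<0 , c₂))
    newton-correct (reject _ oracle₁ ¬cert _ _ rest) it dom (inj₂ (g<0 , c)) =
      let b₁ , it₁ , c₁ , le , dom₁ = oracle-Iterate dom (Iterate.below it) oracle₁
      in newton-correct rest it₁ (dom₁ (NewtonStep.upper it g<0 c))
           (descending (NewtonStep.value≤0 it g<0 c it₁ le) ¬cert c₁)

-- The invariant and its preservation by one phase.

module PhaseCorrectness {a ℓ : Level} (K : OrderedField a ℓ) {n m : ℕ}
  (G : Algorithm.System K n m) where

  open OrderedField K
  open OrderedFieldProperties K
  open Algorithm K
  open ExtendedOrder K
  open WalkBounds K
  open System G

  record Invariant (A : Subset m) (y : Labels n) : Set (a ⊔ ℓ) where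
    field
      dominates : ∀ {z} → Valid G A ([_] ∘ z) → ∀ v → [ z v ] ≤⁺ y v
      valid     : Valid G A y
      ray       : Fin n → Carrier
      ray≥0     : ∀ v → 0# ≤ ray v
      ray-valid : ∀ e → e ∈ A → ray (src e) ≤ gain e * ray (tgt e)
      ray>0     : ∀ v → y v ≡ ⊤⁺ → 0# < ray v

  -- Its solutions are the recession directions of `G`, and its walk bounds are multiplications by
  -- the gain.
  zeroCost : System n m
  zeroCost = record { src = src ; tgt = tgt ; cost = λ _ → 0# ; gain = gain ; gain>0 = gain>0 }

  module SplitTargets (u : Fin n) where

    tgt-split : ∀ e → (System.tgt (split G u) e ≡ zero × tgt e ≡ u) ⊎
                      (System.tgt (split G u) e ≡ suc (tgt e) × tgt e ≢ u)
    tgt-split e with tgt e Fin.≟ u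
    ... | yes tgt≡u = inj₁ (refl , tgt≡u)
    ... | no  tgt≢u = inj₂ (refl , tgt≢u)

    merge : Fin (suc n) → Fin n
    merge = u Vector.∷ λ v → v

    merge-tgt : ∀ e → merge (System.tgt (split G u) e) ≡ tgt e
    merge-tgt e with tgt-split e
    ... | inj₁ (eq , refl) = cong merge eq
    ... | inj₂ (eq , _)    = cong merge eq

    zeroCost-walk : ∀ {A x t P} → IsWalk (split zeroCost u) A x t P → IsWalk G A (merge x) (merge t) P
    zeroCost-walk [] = []
    zeroCost-walk {A} {P = e ∷ P} (e∈A ∷ W) =
      e∈A ∷ subst (λ v → IsWalk G A v _ P) (merge-tgt e) (zeroCost-walk W)

    zeroCost-gain : ∀ P → walkGain (split zeroCost u) P ≡ walkGain G P
    zeroCost-gain []      = refl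
    zeroCost-gain (e ∷ P) = cong (gain e *_) (zeroCost-gain P)

    zeroCost-cost : ∀ P → walkCost (split zeroCost u) P ≡ 0#
    zeroCost-cost []      = refl
    zeroCost-cost (e ∷ P) = trans (+-identityˡ _) (trans (cong (gain e *_) (zeroCost-cost P)) (zeroʳ _))

  module OnePhase {A A′ : Subset m} {y : Labels n} {u : Fin n} (inv : Invariant A y)
    (A⊆A′ : A ⊆ A′) (old : ∀ {e} → e ∈ A′ → src e ≢ u → e ∈ A) where

    open Invariant inv
    open SplitGraph K G A′ u
    open SplitTargets u

    from-sink : ∀ {x t P} → IsWalk Gᵤ A′ x t P → x ≡ zero → t ≡ zero
    from-sink [] eq = eq

    -- A walk that ends in `V` avoids the sink, which has no outgoing arcs. Starting away from `u`,
    -- it uses only arcs present before the phase, for which the ray is known to be valid.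
    ray-walk : ∀ {x t P v w} → IsWalk Gᵤ A′ x t P → x ≡ suc v → t ≡ suc w → v ≢ u →
      ray v ≤ walkGain Gᵤ P * ray w
    ray-walk [] refl refl _ = ≤-reflexive (sym (*-identityˡ _))
    ray-walk {P = e ∷ P} {w = w} (e∈A′ ∷ W) refl t≡ src≢u with tgt-split e
    ... | inj₁ (tgt≡0 , _) with () ← trans (sym t≡) (from-sink W tgt≡0)
    ... | inj₂ (tgt≡ , tgt≢u) = ≤-trans (ray-valid e (old e∈A′ src≢u))
      (subst (gain e * ray (tgt e) ≤_) (sym (*-assoc _ _ _))
        (*-monoʳ-≤ (<⇒≤ (gain>0 e)) (ray-walk W tgt≡ t≡ tgt≢u)))

    -- Where `y v ≡ ⊤⁺` the ray is positive, and a closed walk at `v` of gain `γ` gives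
    -- `ray v ≤ γ * ray v`.
    open Envelope y (λ e e∈A′ src≢u → valid e (old e∈A′ src≢u))
      (λ v≢u y≡⊤ W → expansive-of-potential (ray>0 _ y≡⊤) (ray-walk W refl refl v≢u))

    dominates′ : ∀ {z} → Solution z → ∀ v → [ z v ] ≤⁺ y v
    dominates′ {z} sol = dominates {z} (λ e e∈A → sol e (A⊆A′ e∈A))

    minOut≤envelope : minOut G A′ y u ≤⁺ envelope (suc u)
    minOut≤envelope = subst (minOut G A′ y u ≤⁺_) (sym envelope-u)
      (≤minOut Gᵤ A′ unsunk λ e e∈A′ src≡ →
        ≤⁺-trans (minOut≤arc G A′ y e∈A′ (Fin.suc-injective src≡)) (arcBound-unsunk e))

    initial-≤envelope : ∀ {δ} → InitialLabel G A′ y u [ δ ] → [ δ ] ≤⁺ envelope (suc u)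
    initial-≤envelope (minimum eq) = subst (_≤⁺ envelope (suc u)) eq minOut≤envelope
    initial-≤envelope (cycle eq _) = subst (_ ≤⁺_)
      (sym (⊤⁺≤⇒≡⊤⁺ (subst (_≤⁺ envelope (suc u)) eq minOut≤envelope))) (_ ≤⊤⁺)

    initial-upper : ∀ {δ} → InitialLabel G A′ y u [ δ ] → ∀ {z} → Solution z → z u ≤ δ
    initial-upper (minimum eq) {z} sol = [≤]-injective (subst ([ z u ] ≤⁺_) eq
      (≤minOut G A′ y λ { e e∈A′ refl → ≤⁺-trans (sol e e∈A′)
        (arcBound-mono G A′ {[_] ∘ z} {y} e (dominates′ {z} sol (tgt e))) }))
    initial-upper (cycle {C} _ ((_ , W , _) , γ<1)) {z} sol = contractive-upper γ<1
      ([≤]-injective (Valid⇒≤walkBound G A′ {[_] ∘ z} sol W)) (≤-reflexive (cycle-fixpoint (walkCost G C) γ<1))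

    module Start {δ : Carrier} (init : InitialLabel G A′ y u [ δ ]) where

      ȳ ȳ₁ : Labels (suc n)
      ȳ  = splitLabels G y u δ
      ȳ₁ = grapevine Gᵤ n A′ ȳ

      ȳ-above : ∀ {z} → Solution z → Above z ȳ
      ȳ-above {z} sol = Above-splitLabels {z} (dominates′ {z} sol) (initial-upper init {z} sol)

      ȳ-below : Below ȳ
      ȳ-below = Below-splitLabels (initial-≤envelope init)

      ȳ₁u≤δ : ȳ₁ (suc u) ≤⁺ [ δ ]
      ȳ₁u≤δ = subst (ȳ₁ (suc u) ≤⁺_) (splitLabels-u y δ) (grapevine-≤ Gᵤ A′ n ȳ (suc u))

      decreasing⇒ends-at-sink : ∀ {P b} → GrapevineWalk Gᵤ n A′ ȳ (suc u) P → ȳ₁ (suc u) ≡ [ b ] → b < δ →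
        P ≢ [] × Traced Gᵤ A′ ȳ n (suc u) zero P
      decreasing⇒ends-at-sink {P} {b} gw eq b<δ = nonempty end , subst (λ t → Traced Gᵤ A′ ȳ n (suc u) t P) end T
        where
        T = GrapevineWalk⇒Traced Gᵤ A′ ȳ gw
        end : walkEnd Gᵤ (suc u) P ≡ zero
        end = ends-at-sink (initial-≤envelope init) T (subst (_<⁺ [ δ ]) (sym eq) [ b<δ ])
        nonempty : ∀ {P} → walkEnd Gᵤ (suc u) P ≡ zero → P ≢ []
        nonempty () refl

      -- A nonempty walk shows that the label of `u` fell below `δ`, so it ends at the sink and
      -- yields a cut of slope at least 1 with `b < δ`.
      reject-correct : ∀ {P} → GrapevineWalk Gᵤ n A′ ȳ (suc u) P →
        HasViolatedArc Gᵤ A′ ȳ₁ ⊎ (P ≢ [] × 1# ≤ walkGain Gᵤ P) → ∀ z → ¬ Solution z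
      reject-correct gw (inj₁ viol) z sol = converged {z} sol (ȳ-above {z} sol) ȳ-below viol
      reject-correct {[]}    gw (inj₂ (P≢[] , _)) = contradiction refl P≢[]
      reject-correct {e ∷ P} gw (inj₂ (_ , 1≤γ)) z sol with ≤[]⇒finite ȳ₁u≤δ
      ... | b , eq =
        let b<δ = [<]-injective (subst₂ _<⁺_ eq (splitLabels-u y δ)
                    (traced-decreases Gᵤ A′ ȳ (GrapevineWalk⇒Traced Gᵤ A′ ȳ gw)))
            _ , T = decreasing⇒ends-at-sink gw eq b<δ
        in cut-contradiction (sinkCut {ȳ₁} refl T eq) 1≤γ b<δ {z} sol (initial-upper init {z} sol)

      -- The initial supergradient is `walkGain Gᵤ P - 1#` without a test of where `P` ends. If the
      -- label of `u` fell, `P` does end at the sink; otherwise the function value is 0 and the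
      -- iteration stops at once.
      start-correct : ∀ {P b r} → GrapevineWalk Gᵤ n A′ ȳ (suc u) P →
        ¬ (HasViolatedArc Gᵤ A′ ȳ₁ ⊎ (P ≢ [] × 1# ≤ walkGain Gᵤ P)) →
        ȳ₁ (suc u) ≡ [ b ] → Newton δ (b - δ) (walkGain Gᵤ P - 1#) ȳ₁ r → Correct r
      start-correct {P} {b} gw ¬reject eq newton = newton-correct newton
        (record
          { label-u    = eq
          ; label-sink = sink-fixed n ȳ
          ; f≡         = refl
          ; isValid    = ¬violated⇒Valid Gᵤ A′ {ȳ₁} (¬reject ∘ inj₁)
          ; below      = Below-grapevine n {ȳ} ȳ-below
          })
        (λ {z} sol → Above-grapevine n sol (ȳ-above {z} sol))
        descends
        where
        descends : Descending ȳ₁ b δ (b - δ) (walkGain Gᵤ P - 1#)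
        descends with b ≟ δ
        ... | yes refl = inj₁ (-‿inverseʳ δ)
        ... | no  b≢δ  =
          let P≢[] , T = decreasing⇒ends-at-sink gw eq ([≤]-injective (subst (_≤⁺ [ δ ]) eq ȳ₁u≤δ) , b≢δ)
              γ<1 = ≰⇒> λ 1≤γ → ¬reject (inj₂ (P≢[] , 1≤γ))
          in inj₂ ((b≤δ⇒f≤0 refl (<⇒≤ γ<1) , λ γ-1≡0 → proj₂ γ<1
                     (trans (sym (x-y+y≡x _ 1#)) (trans (cong (_+ 1#) γ-1≡0) (+-identityˡ 1#)))) ,
                   sinkCut refl T eq)

    restrict : Carrier ⁺ → Carrier → Carrier
    restrict ⊤⁺    r = r
    restrict [ _ ] r = 0#

    -- The old ray is set to 0 where labels are finite now. It stays valid because valid labels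
    -- admit no arc from an infinite to a finite label, and because all new arcs leave `u`, whose
    -- label is finite.
    root-Invariant : ∀ {δ ȳ} → IsRoot δ ȳ → Invariant A′ (ȳ ∘ suc)
    root-Invariant {δ} {ȳ} isRoot = record
      { dominates = λ {z} sol v → IsRoot.dominates isRoot {z} sol (suc v)
      ; valid     = valid′
      ; ray       = λ v → restrict (ȳ (suc v)) (ray v)
      ; ray≥0     = λ v → restrict≥0 (ȳ (suc v)) (ray≥0 v)
      ; ray-valid = ray-valid′
      ; ray>0     = λ v ∞ → subst (λ t → 0# < restrict t (ray v)) (sym ∞) (ray>0 v (old-∞ ∞))
      }
      where
      open IsRoot isRoot using (label-u; label-sink; isValid; below)
      valid′ : Valid G A′ (ȳ ∘ suc)
      valid′ = Valid-unsplit {ȳ} (trans label-sink (sym label-u)) isValid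
      restrict≥0 : ∀ t {r} → 0# ≤ r → 0# ≤ restrict t r
      restrict≥0 ⊤⁺    0≤r = 0≤r
      restrict≥0 [ _ ] _   = ≤-refl
      ∞⇒≢u : ∀ {v} → ȳ (suc v) ≡ ⊤⁺ → v ≢ u
      ∞⇒≢u ∞ refl with () ← trans (sym label-u) ∞
      old-∞ : ∀ {v} → ȳ (suc v) ≡ ⊤⁺ → y v ≡ ⊤⁺
      old-∞ {v} ∞ = ⊤⁺≤⇒≡⊤⁺ (subst₂ _≤⁺_ ∞ (envelope-≢u (∞⇒≢u ∞)) (below v))
      ray-valid′ : ∀ e → e ∈ A′ →
        restrict (ȳ (suc (src e))) (ray (src e)) ≤ gain e * restrict (ȳ (suc (tgt e))) (ray (tgt e))
      ray-valid′ e e∈A′ with ȳ (suc (src e)) in src∞ | ȳ (suc (tgt e)) in tgt∞ | valid′ e e∈A′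
      ... | [ _ ] | t     | _ = *-nonNegative (<⇒≤ (gain>0 e)) (restrict≥0 t (ray≥0 (tgt e)))
      ... | ⊤⁺    | ⊤⁺    | _ = ray-valid e (old e∈A′ (∞⇒≢u src∞))

    -- A new ray when the label of `u` stays infinite.

    module Skip (minOut≡⊤ : minOut G A′ y u ≡ ⊤⁺) (noCycle : ∀ C → ¬ FlowAbsorbingCycleAt G A′ u C) where

      module S = SplitGraph K zeroCost A′ u
      -- The old ray plays the part of the labels `y`; being finite everywhere, it satisfies
      -- `nonAbsorbing` vacuously.
      module E = S.Envelope ([_] ∘ ray)
        (λ e e∈A′ src≢u → [ subst (ray (src e) ≤_) (sym (+-identityˡ _)) (ray-valid e (old e∈A′ src≢u)) ])
        (λ _ ())

      Infinite : Fin (suc n) → Set a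
      Infinite x = merge x ≡ u ⊎ y (merge x) ≡ ⊤⁺

      tgt-∞ : ∀ {e} → e ∈ A′ → src e ≡ u ⊎ y (src e) ≡ ⊤⁺ → y (tgt e) ≡ ⊤⁺
      tgt-∞ {e} e∈A′ h = unbounded (y (tgt e)) (bound h)
        where
        unbounded : ∀ t → ⊤⁺ ≤⁺ affine (cost e) (gain e) t → t ≡ ⊤⁺
        unbounded ⊤⁺ _ = refl
        bound-≢u : y (src e) ≡ ⊤⁺ → src e ≢ u → ⊤⁺ ≤⁺ arcBound G y e
        bound-≢u ∞ src≢u = subst (_≤⁺ arcBound G y e) ∞ (valid e (old e∈A′ src≢u))
        bound-u : src e ≡ u → ⊤⁺ ≤⁺ arcBound G y e
        bound-u src≡u = subst (_≤⁺ arcBound G y e) minOut≡⊤ (minOut≤arc G A′ y e∈A′ src≡u)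
        bound : src e ≡ u ⊎ y (src e) ≡ ⊤⁺ → ⊤⁺ ≤⁺ arcBound G y e
        bound (inj₁ src≡u) = bound-u src≡u
        bound (inj₂ ∞) with src e Fin.≟ u
        ... | yes src≡u = bound-u src≡u
        ... | no  src≢u = bound-≢u ∞ src≢u

      -- Makes `ε` at most the zero-cost bound of every arc leaving `u`; these bounds are positive
      -- because the targets have infinite labels.
      lower = common-lower (λ e → gain e * ray (tgt e))
      ε = proj₁ lower

      0<ε : 0# < ε
      0<ε = proj₁ (proj₂ lower)

      labels₀ w : Labels (suc n)
      labels₀ = splitLabels zeroCost ([_] ∘ ray) u ε
      w       = grapevine S.Gᵤ n A′ labels₀

      ε≤envelope : [ ε ] ≤⁺ E.envelope (suc u)
      ε≤envelope = subst ([ ε ] ≤⁺_) (sym E.envelope-u) (≤minOut S.Gᵤ A′ E.unsunk bound)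
        where
        bound : ∀ e → e ∈ A′ → suc (src e) ≡ suc u → [ ε ] ≤⁺ arcBound S.Gᵤ E.unsunk e
        bound e e∈A′ src≡ = ≤⁺-trans
          [ subst (ε ≤_) (sym (+-identityˡ _)) (proj₂ (proj₂ lower) e
              (*-pos (gain>0 e) (ray>0 (tgt e) (tgt-∞ e∈A′ (inj₁ (Fin.suc-injective src≡)))))) ]
          (E.arcBound-unsunk e)

      -- The lower barrier for this run of Grapevine, which therefore converges whether or not `G`
      -- is feasible.
      zero-solution : S.Solution (λ _ → 0#)
      zero-solution e _ = [ ≤-reflexive (sym (trans (+-identityˡ _) (zeroʳ _))) ]

      labels₀-above : E.Above (λ _ → 0#) labels₀
      labels₀-above = E.Above-splitLabels (λ v → [ ray≥0 v ]) (<⇒≤ 0<ε)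

      labels₀-below : E.Below labels₀
      labels₀-below = E.Below-splitLabels ε≤envelope

      w-valid : Valid S.Gᵤ A′ w
      w-valid = ¬violated⇒Valid S.Gᵤ A′ {w} (E.converged zero-solution labels₀-above labels₀-below)

      -- Agreement of `u` with the sink, whose label stays `ε`, lets `w` descend to `G`. If the
      -- label of `u` fell to `b`, the trace would reach the sink, its distinct sources would make
      -- it a cycle at `u`, and `b ≡ γ * ε < ε` would force `γ < 1#`.
      w-u : w (suc u) ≡ [ ε ]
      w-u with ≤[]⇒finite (subst (w (suc u) ≤⁺_) (S.splitLabels-u ([_] ∘ ray) ε) (grapevine-≤ S.Gᵤ A′ n labels₀ (suc u)))
      ... | b , w≡b with ε ≤? b
      ... | yes ε≤b = ≤⁺-antisym
        (subst (w (suc u) ≤⁺_) (S.splitLabels-u ([_] ∘ ray) ε) (grapevine-≤ S.Gᵤ A′ n labels₀ (suc u)))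
        (subst ([ ε ] ≤⁺_) (sym w≡b) [ ε≤b ])
      ... | no  ε≰b with traced S.Gᵤ A′ labels₀ n (suc u)
      ... | t , P , T with E.ends-at-sink ε≤envelope T (subst (_<⁺ [ ε ]) (sym w≡b) [ ≰⇒> ε≰b ])
      ... | refl = contradiction
        ((nonempty (traced-walk S.Gᵤ A′ labels₀ T) ,
          zeroCost-walk (traced-walk S.Gᵤ A′ labels₀ T) ,
          E.traced-unique-src zero-solution labels₀-above labels₀-below T) ,
         ≰⇒> 1≰γ)
        (noCycle P)
        where
        nonempty : ∀ {P} → IsWalk S.Gᵤ A′ (suc u) zero P → P ≢ []
        nonempty (_ ∷ _) ()
        b≡γε : b ≡ walkGain G P * ε
        b≡γε = just-injective (trans (sym w≡b) (trans (traced-value S.Gᵤ A′ labels₀ T)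
          (cong [_] (trans (cong₂ (λ c γ → c + γ * ε) (zeroCost-cost P) (zeroCost-gain P)) (+-identityˡ _)))))
        1≰γ : ¬ 1# ≤ walkGain G P
        1≰γ 1≤γ = ε≰b (subst₂ _≤_ (*-identityʳ ε) (trans (*-comm ε _) (sym b≡γε)) (*-monoʳ-≤ (<⇒≤ 0<ε) 1≤γ))

      -- Arcs from nodes in `Infinite` lead to nodes in `Infinite`, and positive gains preserve
      -- positivity from round to round.
      positive : ∀ i x → Infinite x → ∀ r → grapevine S.Gᵤ i A′ labels₀ x ≡ [ r ] → 0# < r
      positive zero zero inf r eq = subst (0# <_) (just-injective eq) 0<ε
      positive zero (suc v) inf r eq with v Fin.≟ u | inf
      ... | yes refl | _ = subst (0# <_) (just-injective (trans (sym (S.splitLabels-u ([_] ∘ ray) ε)) eq)) 0<ε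
      ... | no  v≢u  | inj₁ v≡u = contradiction v≡u v≢u
      ... | no  v≢u  | inj₂ ∞ = subst (0# <_)
        (just-injective (trans (sym (S.splitLabels-≢u ([_] ∘ ray) ε v≢u)) eq)) (ray>0 v ∞)
      positive (suc i) = relax-induction S.Gᵤ A′ (λ x t → Infinite x → ∀ r → t ≡ [ r ] → 0# < r)
        (positive i) arc
        where
        arc : ∀ {e} → e ∈ A′ → Infinite (suc (src e)) → ∀ r →
          arcBound S.Gᵤ (grapevine S.Gᵤ i A′ labels₀) e ≡ [ r ] → 0# < r
        arc {e} e∈A′ inf r eq with grapevine S.Gᵤ i A′ labels₀ (System.tgt S.Gᵤ e) in eq′
        arc {e} e∈A′ inf r refl | [ t ] = subst (0# <_) (sym (+-identityˡ _))
          (*-pos (gain>0 e) (positive i (System.tgt S.Gᵤ e)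
            (inj₂ (trans (cong y (merge-tgt e)) (tgt-∞ e∈A′ inf))) t eq′))

      w-finite : ∀ v → ∃[ r ] w (suc v) ≡ [ r ]
      w-finite v with v Fin.≟ u
      ... | yes refl = ε , w-u
      ... | no  v≢u  = ≤[]⇒finite (subst (w (suc v) ≤⁺_) (S.splitLabels-≢u ([_] ∘ ray) ε v≢u)
                                    (grapevine-≤ S.Gᵤ A′ n labels₀ (suc v)))

      ray′ : Fin n → Carrier
      ray′ v = proj₁ (w-finite v)

      w≡ray′ : ∀ v → w (suc v) ≡ [ ray′ v ]
      w≡ray′ v = proj₂ (w-finite v)

      setLabel-∞ : ∀ v → setLabel G u ⊤⁺ y v ≡ ⊤⁺ → v ≡ u ⊎ y v ≡ ⊤⁺
      setLabel-∞ v ∞ with v Fin.≟ u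
      ... | yes v≡u = inj₁ v≡u
      ... | no  v≢u = inj₂ (trans (sym (updateAt-minimal v u y v≢u)) ∞)

      ≤setLabel : ∀ v → y v ≤⁺ setLabel G u ⊤⁺ y v
      ≤setLabel v with v Fin.≟ u
      ... | yes refl = subst (y u ≤⁺_) (sym (updateAt-updates u y)) (_ ≤⊤⁺)
      ... | no  v≢u  = ≤⁺-reflexive (sym (updateAt-minimal v u y v≢u))

      skip-valid : Valid G A′ (setLabel G u ⊤⁺ y)
      skip-valid e e∈A′ with src e Fin.≟ u
      ... | yes src≡u = subst (λ t → setLabel G u ⊤⁺ y (src e) ≤⁺ affine (cost e) (gain e) t)
        (sym (⊤⁺≤⇒≡⊤⁺ (subst (_≤⁺ setLabel G u ⊤⁺ y (tgt e)) (tgt-∞ e∈A′ (inj₁ src≡u)) (≤setLabel (tgt e))))) (_ ≤⊤⁺)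
      ... | no  src≢u = subst (_≤⁺ arcBound G (setLabel G u ⊤⁺ y) e) (sym (updateAt-minimal (src e) u y src≢u))
        (≤⁺-trans (valid e (old e∈A′ src≢u)) (arcBound-mono G A′ {y} {setLabel G u ⊤⁺ y} e (≤setLabel (tgt e))))

      skip-Invariant : Invariant A′ (setLabel G u ⊤⁺ y)
      skip-Invariant = record
        { dominates = λ {z} sol v → ≤⁺-trans (dominates′ {z} sol v) (≤setLabel v)
        ; valid     = skip-valid
        ; ray       = ray′
        ; ray≥0     = λ v → [≤]-injective (subst ([ 0# ] ≤⁺_) (w≡ray′ v)
                        (E.Above-grapevine n zero-solution labels₀-above (suc v)))
        ; ray-valid = λ e e∈A′ → subst (ray′ (src e) ≤_) (+-identityˡ _)
            ([≤]-injective (subst₂ (λ s t → s ≤⁺ affine 0# (gain e) t) (w≡ray′ (src e)) (w≡ray′ (tgt e))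
              (S.Valid-unsplit {w} (trans (S.sink-fixed n labels₀) (sym w-u)) w-valid e e∈A′)))
        ; ray>0     = λ v ∞ → positive n (suc v) (setLabel-∞ v ∞) (ray′ v) (w≡ray′ v)
        }

    phase-returns : ∀ {y′} → Phase G A′ y u (returns y′) → Invariant A′ y′
    phase-returns (skip (noCycle minOut≡⊤ none)) = Skip.skip-Invariant minOut≡⊤ none
    phase-returns (newtonSucceeds init gw ¬reject eq newton) =
      root-Invariant (Start.start-correct init gw ¬reject eq newton)

    phase-infeasible : Phase G A′ y u infeasible → ∀ z → ¬ Solution z
    phase-infeasible (reject init gw bad) = Start.reject-correct init gw bad
    phase-infeasible (newtonFails init gw ¬reject eq newton) = Start.start-correct init gw ¬reject eq newton

-- The sequence of phases.

module Correctness {a ℓ : Level} (K : OrderedField a ℓ) {n m : ℕ}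
  (G : Algorithm.System K n m) where

  open OrderedField K
  open OrderedFieldProperties K
  open Algorithm K
  open ExtendedOrder K
  open WalkBounds K
  open System G
  open PhaseCorrectness K G

  ∈δ⁺⇒src≡ : ∀ {e u} → e ∈ δ⁺ G u → src e ≡ u
  ∈δ⁺⇒src≡ {e} {u} e∈ with src e Fin.≟ u in eq
  ... | yes src≡u = src≡u
  ... | no  _ with () ← trans (sym (cong does eq))
                  (trans (sym (lookup∘tabulate (λ e → does (src e Fin.≟ u)) e)) ([]=⇒lookup e∈))

  src≡⇒∈δ⁺ : ∀ {e u} → src e ≡ u → e ∈ δ⁺ G u
  src≡⇒∈δ⁺ {e} {u} src≡u = lookup⇒[]= e _
    (trans (lookup∘tabulate _ e) (dec-true (src e Fin.≟ u) src≡u))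

  ∪δ⁺-old : ∀ A {e u} → e ∈ A ∪ δ⁺ G u → src e ≢ u → e ∈ A
  ∪δ⁺-old A {u = u} e∈ src≢u with x∈p∪q⁻ A (δ⁺ G u) e∈
  ... | inj₁ e∈A = e∈A
  ... | inj₂ e∈δ = contradiction (∈δ⁺⇒src≡ e∈δ) src≢u

  initial-Invariant : Invariant ∅ (const ⊤⁺)
  initial-Invariant = record
    { dominates = λ _ _ → _ ≤⊤⁺
    ; valid     = λ _ _ → _ ≤⊤⁺
    ; ray       = λ _ → 1#
    ; ray≥0     = λ _ → <⇒≤ 0<1
    ; ray-valid = λ _ e∈∅ → contradiction e∈∅ ∉⊥
    ; ray>0     = λ _ _ → 0<1
    }

  IsSolution⇒Valid : ∀ {A z} → IsSolution G z → Valid G A ([_] ∘ z)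
  IsSolution⇒Valid {z = z} sol e _ = [ subst (_≤ cost e + gain e * z (tgt e))
    (x-y+y≡x (z (src e)) (gain e * z (tgt e))) (+-monoˡ-≤ (gain e * z (tgt e)) (sol e)) ]

  ≤⇒IsSolution : ∀ {z} → (∀ e → z (src e) ≤ cost e + gain e * z (tgt e)) → IsSolution G z
  ≤⇒IsSolution {z} sol e = +-cancelʳ-≤ (gain e * z (tgt e))
    (subst (_≤ cost e + gain e * z (tgt e)) (sym (x-y+y≡x (z (src e)) (gain e * z (tgt e)))) (sol e))

  phases-returns : ∀ {us A y y′} → Invariant A y → Phases G us A y (returns y′) →
    ∃[ B ] A ⊆ B × (∀ e → src e ∈ₗ us → e ∈ B) × Invariant B y′
  phases-returns {A = A} inv done = A , (λ e∈A → e∈A) , (λ _ ()) , inv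
  phases-returns {u ∷ us} {A} inv (next phase phases) =
    let B , A′⊆B , cover , inv′ = phases-returns
          (OnePhase.phase-returns inv (p⊆p∪q (δ⁺ G u)) (∪δ⁺-old A) phase) phases
    in B , (λ e∈A → A′⊆B (p⊆p∪q (δ⁺ G u) e∈A)) ,
       (λ { e (here src≡u) → A′⊆B (q⊆p∪q A (δ⁺ G u) (src≡⇒∈δ⁺ src≡u)) ; e (there src∈) → cover e src∈ }) , inv′

  phases-infeasible : ∀ {us A y} → Invariant A y → Phases G us A y infeasible → ¬ Feasible G
  phases-infeasible {u ∷ us} {A} inv (fail phase) (z , sol) =
    OnePhase.phase-infeasible inv (p⊆p∪q (δ⁺ G u)) (∪δ⁺-old A) phase z (IsSolution⇒Valid {z = z} sol)
  phases-infeasible {u ∷ us} {A} inv (next phase phases) =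
    phases-infeasible (OnePhase.phase-returns inv (p⊆p∪q (δ⁺ G u)) (∪δ⁺-old A) phase) phases

  -- From the invariant to the pointwise maximal solution.

  module FinalLabels {A : Subset m} {y : Labels n} (inv : Invariant A y) (all : ∀ e → e ∈ A)
    (z₀ : Fin n → Carrier) (sol₀ : IsSolution G z₀) where

    open Invariant inv

    z₀≤ : ∀ e → z₀ (src e) ≤ cost e + gain e * z₀ (tgt e)
    z₀≤ e = [≤]-injective (IsSolution⇒Valid {A} {z₀} sol₀ e (all e))

    shifted : Carrier → Fin n → Carrier
    shifted t v = z₀ v + t * ray v

    shifted≤ : ∀ {t} → 0# ≤ t → ∀ e → shifted t (src e) ≤ cost e + gain e * shifted t (tgt e)
    shifted≤ {t} 0≤t e = subst (shifted t (src e) ≤_)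
      (solve 5 (λ c γ x t d → c :+ γ :* x :+ t :* (γ :* d) := c :+ γ :* (x :+ t :* d)) refl
        (cost e) (gain e) (z₀ (tgt e)) t (ray (tgt e)))
      (+-mono-≤ (z₀≤ e) (*-monoʳ-≤ 0≤t (ray-valid e (all e))))

    shifted-mono : ∀ v {s t} → s ≤ t → shifted s v ≤ shifted t v
    shifted-mono v {s} {t} s≤t = +-monoʳ-≤ (z₀ v)
      (subst₂ _≤_ (*-comm (ray v) s) (*-comm (ray v) t) (*-monoʳ-≤ (ray≥0 v) s≤t))

    unbounded : ∀ v → y v ≡ ⊤⁺ → UnboundedAbove G v
    unbounded v ∞ b with ray-reaches (ray>0 v ∞) (z₀ v) (b + 1#)
    ... | t , 0≤t , b+1≤ = shifted t , ≤⇒IsSolution {shifted t} (shifted≤ 0≤t) , <-≤-trans b<b+1 b+1≤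
      where
      b<b+1 : b < b + 1#
      b<b+1 = x≤x+t b (<⇒≤ 0<1) , λ eq → 0≢1 (+-cancelˡ b 0# 1# (trans (+-identityʳ b) eq))

    infinite : ∀ v → UnboundedAbove G v → y v ≡ ⊤⁺
    infinite v unb with y v in eq
    ... | ⊤⁺    = refl
    ... | [ r ] =
      let z , sol , r<z = unb r
      in contradiction ([≤]-injective (subst ([ z v ] ≤⁺_) eq (dominates {z} (IsSolution⇒Valid {z = z} sol) v)))
           (<⇒≱ r<z)

    -- Concerns arcs from a finite to an infinite label, the ones that require a point far out along
    -- the ray.
    Slack : Fin m → Carrier → Set (a ⊔ ℓ)
    Slack e t = ∀ {r} → y (src e) ≡ [ r ] → y (tgt e) ≡ ⊤⁺ → r ≤ cost e + gain e * shifted t (tgt e)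

    slack : ∀ e → ∃[ t ] 0# ≤ t × Slack e t
    slack e with y (src e) | y (tgt e) in tgt-eq
    ... | ⊤⁺    | _     = 0# , ≤-refl , λ ()
    ... | [ _ ] | [ _ ] = 0# , ≤-refl , λ _ ()
    -- The quotient is the value at the target for which `e` is tight when its source has value `r`.
    ... | [ r ] | ⊤⁺ with ray-reaches (ray>0 (tgt e) tgt-eq) (z₀ (tgt e)) ((r - cost e) ÷ gain e)
    ... | t , 0≤t , s≤ = t , 0≤t , λ { refl _ →
            subst (_≤ cost e + gain e * shifted t (tgt e)) r≡ (affine-mono-≤ (cost e) (<⇒≤ (gain>0 e)) s≤) }
      where
      r≡ : cost e + gain e * ((r - cost e) ÷ gain e) ≡ r
      r≡ = trans (cong (cost e +_) (trans (*-comm (gain e) _) (÷-* (<⇒≢0 (gain>0 e)))))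
             (trans (+-comm (cost e) _) (x-y+y≡x r (cost e)))

    slack-mono : ∀ e {s t} → s ≤ t → Slack e s → Slack e t
    slack-mono e s≤t sl src≡ tgt≡ = ≤-trans (sl src≡ tgt≡)
      (affine-mono-≤ (cost e) (<⇒≤ (gain>0 e)) (shifted-mono (tgt e) s≤t))

    fill : Carrier ⁺ → Carrier → Carrier
    fill [ r ] _ = r
    fill ⊤⁺    x = x

    -- Finite labels are kept and infinite ones filled in from a solution moved along the ray. Arcs
    -- between finite labels hold by validity of `y`, arcs between infinite ones by that solution,
    -- and mixed ones by `Slack`; validity excludes arcs from an infinite to a finite label.
    attained : ∃[ z ] IsSolution G z × (∀ v {r} → y v ≡ [ r ] → z v ≡ r)
    attained with common-upper Slack slack-mono slack
    ... | t , 0≤t , slacks = z , ≤⇒IsSolution {z} z≤ , λ v eq → cong (λ s → fill s (shifted t v)) eq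
      where
      z : Fin n → Carrier
      z v = fill (y v) (shifted t v)
      z≤ : ∀ e → z (src e) ≤ cost e + gain e * z (tgt e)
      z≤ e with y (src e) | y (tgt e) | valid e (all e) | slacks e
      ... | ⊤⁺    | ⊤⁺    | _     | _ = shifted≤ 0≤t e
      ... | [ _ ] | [ _ ] | [ p ] | _ = p
      ... | [ _ ] | ⊤⁺    | _     | sl = sl refl refl

    isYMax : IsYMax G y
    isYMax = record
      { dominates = λ z sol → dominates {z} (IsSolution⇒Valid {z = z} sol)
      ; attained  = attained
      ; infinite  = λ v → mk⇔ (unbounded v) (infinite v)
      }

theorem4p8 : ∀ {a ℓ : Level} (K : OrderedField a ℓ) → let open Algorithm K in
    ∀ {n m : ℕ} (G : System n m) →
    (∀ y → Algorithm3 G (returns y) → Feasible G → IsYMax G y)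
    × (Algorithm3 G infeasible → ¬ Feasible G)
theorem4p8 K {n} G =
  (λ { y (order , perm , phases) (z₀ , sol₀) →
       let _ , _ , cover , inv = phases-returns initial-Invariant phases
       in FinalLabels.isYMax inv (λ e → cover e (∈-resp-↭ (↭-sym perm) (∈-allFin (src e)))) z₀ sol₀ }) ,
  λ { (_ , _ , phases) → phases-infeasible initial-Invariant phases }
  where
  open Algorithm K
  open System G
  open Correctness K G
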